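{- Let $k$ be a positive integer with $k \equiv 0 \pmod 5$ and let \[ n = L_{CC}(10,k) = \frac{512k^5+1280k^4+6400k^3+8000k^2+6250k+3125}{3125}. \] Then there is an undirected Cayley graph of the cyclic group $\mathbb{Z}_n$ on five generators which has diameter $k$. Moreover, a generating set for such a graph is \[ \Big\{1,\ \tfrac{32k^3+40k^2+300k+125}{125},\ \tfrac{128k^4+160k^3+1200k^2-625}{625},\ \tfrac{128k^4+320k^3+1600k^2+1750k+1250}{625},\ \tfrac{256k^4+640k^3+3000k^2+3750k+1250}{625}\Big\}, \] i.e. the Cayley graph of $\mathbb{Z}_n$ with connection set $\{\pm g_1,\dots,\pm g_5\}$, where $g_1,\dots,g_5$ are these integers taken modulo $n$, has diameter $k$.
   Context: For a positive integer $n$ and integers $g_1,\dots,g_5$, the undirected Cayley (circulant) graph of the cyclic group $\mathbb{Z}_n$ with generating set $\{g_1,\dots,g_5\}$ has vertex set $\mathbb{Z}_n$, with $i$ and $j$ adjacent if and only if $j-i \equiv \pm g_t \pmod n$ for some $t$. Its diameter is the maximum over pairs of vertices of the graph distance. The notation $L_{CC}(10,k)$ is just a name for the displayed polynomial value. -}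

module Defs where

open import Data.Nat as N using (ℕ; zero; suc; _∸_; _/_)
open import Data.Fin using (Fin; toℕ)
open import Data.Vec using (Vec; lookup; _∷_; [])
open import Data.Integer as ℤ using (ℤ; +_)
open import Data.Integer.Divisibility using (_∣_)
open import Data.Integer.DivMod using (_/ℕ_)
open import Data.Product using (∃; _×_)
open import Data.Sum using (_⊎_)
open import Relation.Nullary using (¬_)

Adj : (n : ℕ) {r : ℕ} → Vec ℤ r → Fin n → Fin n → Set
Adj n {r} gs i j = ∃ λ (t : Fin r) →
  ((+ n) ∣ ((+ toℕ j ℤ.- + toℕ i) ℤ.- lookup gs t))
  ⊎ ((+ n) ∣ ((+ toℕ j ℤ.- + toℕ i) ℤ.+ lookup gs t))

data Walk (n : ℕ) {r : ℕ} (gs : Vec ℤ r) : ℕ → Fin n → Fin n → Set where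
  here : ∀ {i} → Walk n gs 0 i i
  step : ∀ {ℓ i j k} → Adj n gs i j → Walk n gs ℓ j k → Walk n gs (suc ℓ) i k

DistLe : (n : ℕ) {r : ℕ} → Vec ℤ r → Fin n → Fin n → ℕ → Set
DistLe n gs i j d = ∃ λ ℓ → (ℓ N.≤ d) × Walk n gs ℓ i j

HasDiameter : (n : ℕ) {r : ℕ} → Vec ℤ r → ℕ → Set
HasDiameter n gs d =
  (∀ i j → DistLe n gs i j d) ×
  ∃ λ i → ∃ λ j → ∀ ℓ → Walk n gs ℓ i j → d N.≤ ℓ

open N using (_+_; _*_; _^_)

L-CC : ℕ → ℕ
L-CC k = (512 * k ^ 5 + 1280 * k ^ 4 + 6400 * k ^ 3 + 8000 * k ^ 2 + 6250 * k + 3125) / 3125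

gens : ℕ → Vec ℤ 5
gens k =
  + 1 ∷
  + ((32 * k ^ 3 + 40 * k ^ 2 + 300 * k + 125) / 125) ∷
  (+ (128 * k ^ 4 + 160 * k ^ 3 + 1200 * k ^ 2) ℤ.- + 625) /ℕ 625 ∷
  + ((128 * k ^ 4 + 320 * k ^ 3 + 1600 * k ^ 2 + 1750 * k + 1250) / 625) ∷
  + ((256 * k ^ 4 + 640 * k ^ 3 + 3000 * k ^ 2 + 3750 * k + 1250) / 625) ∷ []

{-# OPTIONS --safe #-}
module Submission where

-- Write k = 5a.  Closed walks correspond to the lattice L of all w ∈ ℤ⁵ with n ∣ w · g, and L consists
-- of the vectors ½ Σ mᵢ Aᵢ whose mᵢ ∈ ℤ have equal parity, where the matrix with rows
--
--   A₁ = (4a, 1, 1, 1, -1)      A₂ = (-1, 4a+1, 0, 1, -1)    A₃ = (-1, 0, 4a, 1, 0)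
--   A₄ = (-1, -1, -1, 4a+1, 0)  A₅ = (1, 1, 0, 0, 4a)
--
-- is a diagonal matrix plus a skew-symmetric one.
--
-- Lower bound: if all mᵢ are odd and σ is the sign vector of m, then ‖w‖ ≥ σ · w ≥ ½ σᵀAσ = 10a + 1,
-- because the skew part contributes nothing.  So odd lattice vectors have ℓ¹-norm at least 2k + 1, and
-- the vertex half way along an odd lattice vector of norm 2k + 1 has distance k from 0.
--
-- Upper bound: since 1 is a generator, it is enough to shorten every x with ‖x‖ = k + 1 and x₁ > 0 by
-- a lattice vector.  In every orthant this is done by a decision tree on the coordinates of x: a
-- coordinate well above 2a in absolute value is reduced by ± Aᵢ, and if there is none, then x is close
-- to the box spanned by some ½ Σ ± Aᵢ, whose norm is 2k + 1.

open import Defs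
open import Data.Bool using (Bool; _∧_; _∨_; T)
open import Data.Bool.Properties using (T-∧; T-∨)
open import Data.Fin as Fin using (Fin; toℕ; #_)
import Data.Fin.Properties as Fin
open import Data.Integer hiding (suc; _<_; _%_)
open import Data.Integer.DivMod using (_%ℕ_; _/ℕ_; n%ℕd<d; a≡a%ℕn+[a/ℕn]*n)
open import Data.Integer.Divisibility.Signed
  using (_∣_; _∣?_; divides; ∣ᵤ⇒∣; ∣⇒∣ᵤ; ∣m∣n⇒∣m+n; ∣m∣n⇒∣m-n; ∣n⇒∣m*n)
open import Data.Integer.Properties
open import Data.Integer.Tactic.RingSolver using (solve; solve-∀)
import Data.List.Base as L
open import Data.Nat as ℕ using (ℕ; zero; suc; _<_; _%_)
import Data.Nat.Divisibility as ℕ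
import Data.Nat.DivMod as ℕ
import Data.Nat.Properties as ℕ
import Data.Nat.Tactic.RingSolver as ℕ
open import Data.Product using (∃; _×_; _,_; proj₁; proj₂; map₁; map₂)
open import Data.Sign using (Sign)
open import Data.Sum using (_⊎_; inj₁; inj₂)
open import Data.Unit using (⊤; tt)
open import Data.Vec using (Vec; []; _∷_; lookup; map; replicate; updateAt; zipWith)
open import Data.Vec.Relation.Unary.All using (All; []; _∷_)
open import Function.Bundles using (Equivalence)
open import Relation.Binary.PropositionalEquality
open import Relation.Nullary using (¬_; contradiction; yes; no)

-- Integer vectors and the ℓ¹-norm

infix 8 _·_
_·_ : ∀ {r} → Vec ℤ r → Vec ℤ r → ℤ
[]       · []       = 0ℤ
(x ∷ xs) · (y ∷ ys) = x * y + xs · ys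

‖_‖ : ∀ {r} → Vec ℤ r → ℕ
‖ [] ‖     = 0
‖ x ∷ xs ‖ = ∣ x ∣ ℕ.+ ‖ xs ‖

·-zeroˡ : ∀ {r} (gs : Vec ℤ r) → replicate r 0ℤ · gs ≡ 0ℤ
·-zeroˡ []       = refl
·-zeroˡ (g ∷ gs) = trans (+-identityˡ _) (·-zeroˡ gs)

‖0‖≡0 : ∀ r → ‖ replicate r 0ℤ ‖ ≡ 0
‖0‖≡0 zero    = refl
‖0‖≡0 (suc r) = ‖0‖≡0 r

updateAt-· : ∀ {r} (xs gs : Vec ℤ r) t e →
  updateAt xs t (_+_ e) · gs ≡ e * lookup gs t + xs · gs
updateAt-· (x ∷ xs) (g ∷ gs) Fin.zero e = lemma e x g (xs · gs)
  where
  lemma : ∀ e x g p → (e + x) * g + p ≡ e * g + (x * g + p)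
  lemma = solve-∀
updateAt-· (x ∷ xs) (g ∷ gs) (Fin.suc t) e =
  trans (cong (_+_ (x * g)) (updateAt-· xs gs t e)) (lemma (x * g) (e * lookup gs t) (xs · gs))
  where
  lemma : ∀ u v p → u + (v + p) ≡ v + (u + p)
  lemma = solve-∀

‖updateAt‖≤ : ∀ {r} (xs : Vec ℤ r) t e → ‖ updateAt xs t (_+_ e) ‖ ℕ.≤ ∣ e ∣ ℕ.+ ‖ xs ‖
‖updateAt‖≤ (x ∷ xs) Fin.zero e = ℕ.≤-trans
  (ℕ.+-monoˡ-≤ ‖ xs ‖ (∣i+j∣≤∣i∣+∣j∣ e x)) (ℕ.≤-reflexive (ℕ.+-assoc ∣ e ∣ ∣ x ∣ ‖ xs ‖))
‖updateAt‖≤ (x ∷ xs) (Fin.suc t) e = begin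
  ∣ x ∣ ℕ.+ ‖ updateAt xs t (_+_ e) ‖   ≤⟨ ℕ.+-monoʳ-≤ ∣ x ∣ (‖updateAt‖≤ xs t e) ⟩
  ∣ x ∣ ℕ.+ (∣ e ∣ ℕ.+ ‖ xs ‖)         ≡⟨ ℕ.+-assoc ∣ x ∣ ∣ e ∣ ‖ xs ‖ ⟨
  ∣ x ∣ ℕ.+ ∣ e ∣ ℕ.+ ‖ xs ‖           ≡⟨ cong (ℕ._+ ‖ xs ‖) (ℕ.+-comm ∣ x ∣ ∣ e ∣) ⟩
  ∣ e ∣ ℕ.+ ∣ x ∣ ℕ.+ ‖ xs ‖           ≡⟨ ℕ.+-assoc ∣ e ∣ ∣ x ∣ ‖ xs ‖ ⟩
  ∣ e ∣ ℕ.+ (∣ x ∣ ℕ.+ ‖ xs ‖)         ∎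
  where open ℕ.≤-Reasoning

_⊟_ : ∀ {r} → Vec ℤ r → Vec ℤ r → Vec ℤ r
_⊟_ = zipWith _-_

_⊞_ : ∀ {r} → Vec ℤ r → Vec ℤ r → Vec ℤ r
_⊞_ = zipWith _+_

⊞-· : ∀ {r} (x y gs : Vec ℤ r) → (x ⊞ y) · gs ≡ x · gs + y · gs
⊞-· []       []       []       = refl
⊞-· (x ∷ xs) (y ∷ ys) (g ∷ gs) rewrite ⊞-· xs ys gs = lemma x y g (xs · gs) (ys · gs)
  where
  lemma : ∀ x y g p q → (x + y) * g + (p + q) ≡ (x * g + p) + (y * g + q)
  lemma = solve-∀

⊟-· : ∀ {r} (x y gs : Vec ℤ r) → (x ⊟ y) · gs ≡ x · gs - y · gs
⊟-· []       []       []       = refl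
⊟-· (x ∷ xs) (y ∷ ys) (g ∷ gs) rewrite ⊟-· xs ys gs = lemma x y g (xs · gs) (ys · gs)
  where
  lemma : ∀ x y g p q → (x - y) * g + (p - q) ≡ (x * g + p) - (y * g + q)
  lemma = solve-∀

-- Generic in the operation because the lower bound needs it for both `_⊟_` and `_⊞_`.
‖zipWith‖≤ : ∀ {r} (_∙_ : ℤ → ℤ → ℤ) → (∀ i j → ∣ i ∙ j ∣ ℕ.≤ ∣ i ∣ ℕ.+ ∣ j ∣) →
  (x y : Vec ℤ r) → ‖ zipWith _∙_ x y ‖ ℕ.≤ ‖ x ‖ ℕ.+ ‖ y ‖
‖zipWith‖≤ _∙_ tri []       []       = ℕ.z≤n
‖zipWith‖≤ _∙_ tri (x ∷ xs) (y ∷ ys) = ℕ.≤-trans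
  (ℕ.+-mono-≤ (tri x y) (‖zipWith‖≤ _∙_ tri xs ys))
  (ℕ.≤-reflexive (lemma ∣ x ∣ ∣ y ∣ ‖ xs ‖ ‖ ys ‖))
  where
  lemma : ∀ a b c d → a ℕ.+ b ℕ.+ (c ℕ.+ d) ≡ a ℕ.+ c ℕ.+ (b ℕ.+ d)
  lemma = ℕ.solve-∀

∣x∣-signed : ∀ x → ∃ λ s → ∣ s ∣ ≡ 1 × + ∣ x ∣ ≡ s * x
∣x∣-signed x with +∣i∣≡i⊎+∣i∣≡-i x
... | inj₁ p = 1ℤ , refl , trans p (sym (*-identityˡ x))
... | inj₂ p = -1ℤ , refl , trans p (sym (-1*i≡-i x))

signed≤∣x∣ : ∀ s x → ∣ s ∣ ≡ 1 → s * x ≤ + ∣ x ∣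
signed≤∣x∣ s x ∣s∣≡1 = ≤-trans (i≤∣i∣ (s * x))
  (≤-reflexive (cong +_ (trans (abs-* s x) (trans (cong (ℕ._* ∣ x ∣) ∣s∣≡1) (ℕ.*-identityˡ ∣ x ∣)))))
  where
  i≤∣i∣ : ∀ i → i ≤ + ∣ i ∣
  i≤∣i∣ (+ n)    = ≤-refl
  i≤∣i∣ -[1+ n ] = -≤+

linear-≤-endpoint : ∀ d {lo x hi} → lo ≤ x → x ≤ hi → d * x ≤ d * lo ⊎ d * x ≤ d * hi
linear-≤-endpoint (+ n)    p q = inj₂ (*-monoˡ-≤-nonNeg (+ n) q)
linear-≤-endpoint -[1+ n ] p q = inj₁ (*-monoˡ-≤-nonPos -[1+ n ] p)

-- Let s be the sign of x - w. The affine function s (y - w) + d y of y agrees with |y - w| + d y at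
-- y = x and never exceeds it elsewhere; on an interval it is largest at an endpoint.
convex-≤-endpoint : ∀ d w {lo x hi} u → lo ≤ x → x ≤ hi →
  + ∣ lo - w ∣ + d * lo ≤ u → + ∣ hi - w ∣ + d * hi ≤ u → + ∣ x - w ∣ + d * x ≤ u
convex-≤-endpoint d w {lo} {x} {hi} u lo≤x x≤hi lo≤u hi≤u
  with s , ∣s∣≡1 , p ← ∣x∣-signed (x - w) = bound
  where
  rearrange : ∀ s d x w → s * (x - w) + d * x ≡ (s + d) * x - s * w
  rearrange = solve-∀
  at : ∀ y → (s + d) * x ≤ (s + d) * y → + ∣ y - w ∣ + d * y ≤ u → + ∣ x - w ∣ + d * x ≤ u
  at y le y≤u = begin
    + ∣ x - w ∣ + d * x     ≡⟨ cong (_+ d * x) p ⟩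
    s * (x - w) + d * x     ≡⟨ rearrange s d x w ⟩
    (s + d) * x - s * w     ≤⟨ +-monoˡ-≤ (- (s * w)) le ⟩
    (s + d) * y - s * w     ≡⟨ rearrange s d y w ⟨
    s * (y - w) + d * y     ≤⟨ +-monoˡ-≤ (d * y) (signed≤∣x∣ s (y - w) ∣s∣≡1) ⟩
    + ∣ y - w ∣ + d * y     ≤⟨ y≤u ⟩
    u                       ∎
    where open ≤-Reasoning
  bound : + ∣ x - w ∣ + d * x ≤ u
  bound with linear-≤-endpoint (s + d) lo≤x x≤hi
  ... | inj₁ le = at lo le lo≤u
  ... | inj₂ le = at hi le hi≤u

-- Walks and integer vectors

module _ (n : ℕ) {r : ℕ} (gs : Vec ℤ r) where

  -- Divisibility here is the signed relation, whose integer quotient enters the later computations;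
  -- `Adj` uses the one on absolute values, hence the conversions `∣ᵤ⇒∣` and `∣⇒∣ᵤ`.
  Displacement : ℤ → Fin n → Fin n → Set
  Displacement v i j = + n ∣ (+ toℕ j - + toℕ i) - v

  displacement-∙ : ∀ {u v i j k} →
    Displacement u i j → Displacement v j k → Displacement (u + v) i k
  displacement-∙ {u} {v} {i} {j} {k} p q =
    subst (+ n ∣_) (lemma (+ toℕ i) (+ toℕ j) (+ toℕ k) u v) (∣m∣n⇒∣m+n p q)
    where
    lemma : ∀ i j k u v → ((j - i) - u) + ((k - j) - v) ≡ (k - i) - (u + v)
    lemma = solve-∀

  displacement-/ : ∀ {u v i j k} →
    Displacement u i j → Displacement (u + v) i k → Displacement v j k
  displacement-/ {u} {v} {i} {j} {k} p q =
    subst (+ n ∣_) (lemma (+ toℕ i) (+ toℕ j) (+ toℕ k) u v) (∣m∣n⇒∣m-n q p)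
    where
    lemma : ∀ i j k u v → ((k - i) - (u + v)) - ((j - i) - u) ≡ (k - j) - v
    lemma = solve-∀

  adj⇒displacement : ∀ {i j} → Adj n gs i j →
    ∃ λ t → ∃ λ e → ∣ e ∣ ≡ 1 × Displacement (e * lookup gs t) i j
  adj⇒displacement {i} {j} (t , inj₁ d) =
    t , 1ℤ , refl , subst (λ g → + n ∣ (+ toℕ j - + toℕ i) - g) (sym (*-identityˡ (lookup gs t))) (∣ᵤ⇒∣ d)
  adj⇒displacement {i} {j} (t , inj₂ d) =
    t , -1ℤ , refl , subst (+ n ∣_) (lemma (+ toℕ j - + toℕ i) (lookup gs t)) (∣ᵤ⇒∣ d)
    where
    lemma : ∀ v g → v + g ≡ v - -1ℤ * g
    lemma = solve-∀

  -- Each step adds ±1 to the entry of its generator. Opposite steps cancel, so the norm can be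
  -- smaller than the length.
  walk⇒vector : ∀ {ℓ i j} → Walk n gs ℓ i j →
    ∃ λ x → ‖ x ‖ ℕ.≤ ℓ × Displacement (x · gs) i j
  walk⇒vector {i = i} here =
    replicate r 0ℤ , ℕ.≤-reflexive (‖0‖≡0 r) ,
    divides 0ℤ (trans (cong (_-_ (+ toℕ i - + toℕ i)) (·-zeroˡ gs)) (lemma (+ toℕ i)))
    where
    lemma : ∀ i → i - i - 0ℤ ≡ 0ℤ
    lemma = solve-∀
  walk⇒vector {suc ℓ} {i} {k} (step {j = j} adj w) with adj⇒displacement {i} {j} adj | walk⇒vector w
  ... | t , e , ∣e∣≡1 , d | x , ‖x‖≤ℓ , d′ =
    updateAt x t (_+_ e) ,
    ℕ.≤-trans (‖updateAt‖≤ x t e)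
      (subst (λ m → m ℕ.+ ‖ x ‖ ℕ.≤ suc ℓ) (sym ∣e∣≡1) (ℕ.s≤s ‖x‖≤ℓ)) ,
    subst (λ v → Displacement v i k) (sym (updateAt-· x gs t e))
      (displacement-∙ {e * lookup gs t} {x · gs} {i} {j} {k} d d′)

  -- Vertices are represented in [0, n), so |j - i| < n, and the only such multiple of n is 0.
  displacement-0 : ∀ {i j} → Displacement 0ℤ i j → i ≡ j
  displacement-0 {i} {j} d = Fin.toℕ-injective (sym (+-injective (i-j≡0⇒i≡j _ _
    (∣i∣≡0⇒i≡0 (small _ (ℕ.≤-<-trans bound (ℕ.⊔-lub (Fin.toℕ<n j) (Fin.toℕ<n i))) (∣⇒∣ᵤ d′))))))
    where
    d′ : + n ∣ + toℕ j - + toℕ i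
    d′ = subst (+ n ∣_) (+-identityʳ _) d
    bound : ∣ + toℕ j - + toℕ i ∣ ℕ.≤ toℕ j ℕ.⊔ toℕ i
    bound = subst (λ v → ∣ v ∣ ℕ.≤ toℕ j ℕ.⊔ toℕ i) (sym (m-n≡m⊖n (toℕ j) (toℕ i))) (∣m⊝n∣≤m⊔n (toℕ j) (toℕ i))
    small : ∀ m → m ℕ.< n → n ℕ.∣ m → m ≡ 0
    small zero    _   _   = refl
    small (suc m) m<n n∣m = contradiction n∣m (ℕ.>⇒∤ m<n)

  translate : ∀ i v → ∃ λ j → Displacement v i j
  translate i v = j , divides (- q) eq
    where
    instance
      n≢0 = Fin.nonZeroIndex i
    q = (+ toℕ i + v) /ℕ n
    j = Fin.fromℕ< (n%ℕd<d (+ toℕ i + v) n)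
    lemma : ∀ i v m qn → i + v ≡ m + qn → m - i - v ≡ - qn
    lemma i v m qn p = trans (rearrange i v m) (trans (cong (_-_ m) p) (cancel m qn))
      where
      rearrange : ∀ i v m → m - i - v ≡ m - (i + v)
      rearrange = solve-∀
      cancel : ∀ m qn → m - (m + qn) ≡ - qn
      cancel = solve-∀
    eq : + toℕ j - + toℕ i - v ≡ - q * + n
    eq rewrite Fin.toℕ-fromℕ< (n%ℕd<d (+ toℕ i + v) n) =
      trans (lemma (+ toℕ i) v (+ ((+ toℕ i + v) %ℕ n)) (q * + n) (a≡a%ℕn+[a/ℕn]*n (+ toℕ i + v) n)) (neg-distribˡ-* q (+ n))

  -- The endpoints are quantified inside because prepending a step changes the starting vertex
  -- during the induction on v.
  Reach : ℕ → ℤ → Set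
  Reach d v = ∀ i j → Displacement v i j → Walk n gs d i j

  reach-0 : Reach 0 0ℤ
  reach-0 i j d with refl ← displacement-0 {i} {j} d = here

  reach-+ : ∀ t {d v} → Reach d v → Reach (suc d) (lookup gs t + v)
  reach-+ t w i k p with translate i (lookup gs t)
  ... | j , q = step (t , inj₁ (∣⇒∣ᵤ q)) (w j k (displacement-/ {lookup gs t} {_} {i} {j} {k} q p))

  reach-- : ∀ t {d v} → Reach d v → Reach (suc d) (- lookup gs t + v)
  reach-- t w i k p with translate i (- lookup gs t)
  ... | j , q = step (t , inj₂ (∣⇒∣ᵤ (subst (λ g → + n ∣ + toℕ j - + toℕ i + g) (neg-involutive (lookup gs t)) q)))
                     (w j k (displacement-/ { - lookup gs t} {_} {i} {j} {k} q p))

  reach-* : ∀ t x {d v} → Reach d v → Reach (∣ x ∣ ℕ.+ d) (x * lookup gs t + v)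
  reach-* t (+ zero) {d} {v} w = subst (Reach d) (lemma (lookup gs t) v) w
    where
    lemma : ∀ g v → v ≡ 0ℤ * g + v
    lemma = solve-∀
  reach-* t (+ suc x) {d} {v} w =
    subst (Reach _) (lemma (lookup gs t) (+ x) v) (reach-+ t (reach-* t (+ x) w))
    where
    lemma : ∀ g x v → g + (x * g + v) ≡ (1ℤ + x) * g + v
    lemma = solve-∀
  reach-* t -[1+ zero ] {d} {v} w = subst (Reach _) (lemma (lookup gs t) v) (reach-- t w)
    where
    lemma : ∀ g v → - g + v ≡ -1ℤ * g + v
    lemma = solve-∀
  reach-* t -[1+ suc x ] {d} {v} w =
    subst (Reach _) (lemma (lookup gs t) -[1+ x ] v) (reach-- t (reach-* t -[1+ x ] w))
    where
    lemma : ∀ g x v → - g + (x * g + v) ≡ (-1ℤ + x) * g + v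
    lemma = solve-∀

  -- Induction over suffixes `hs` of the generators: the hypothesis keeps every entry of the suffix
  -- available as a step of the full graph.
  reach-part : ∀ {s} (x hs : Vec ℤ s) →
    (∀ t → ∃ λ t′ → lookup gs t′ ≡ lookup hs t) → Reach ‖ x ‖ (x · hs)
  reach-part []       []       h = reach-0
  reach-part (x ∷ xs) (g ∷ hs) h with h Fin.zero
  ... | t , refl = reach-* t x (reach-part xs hs (λ t → h (Fin.suc t)))

  vector⇒walk : ∀ x → Reach ‖ x ‖ (x · gs)
  vector⇒walk x = reach-part x gs (λ t → t , refl)

-- Odd lattice vectors

-- The order n of the group and the generators as polynomials in a = k / 5.
opaque

  order : ℤ → ℤ
  order a = + 1 + a * (+ 10 + a * (+ 64 + a * (+ 256 + a * (+ 256 + a * + 512))))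

  otherGenerators : ℤ → Vec ℤ 4
  otherGenerators a =
    + 1 + a * (+ 12 + a * (+ 8 + a * + 32)) ∷
    a * (a * (+ 48 + a * (+ 32 + a * + 128))) - 1ℤ ∷
    + 2 + a * (+ 14 + a * (+ 64 + a * (+ 64 + a * + 128))) ∷
    + 2 + a * (+ 30 + a * (+ 120 + a * (+ 128 + a * + 256))) ∷ []

generators : ℤ → Vec ℤ 5
generators a = 1ℤ ∷ otherGenerators a

unit-square : ∀ s → ∣ s ∣ ≡ 1 → s * s ≡ 1ℤ
unit-square (+ 1)      refl = refl
unit-square -[1+ zero ] refl = refl

nonzero-signed : ∀ m → m ≢ 0ℤ → ∃ λ s → ∃ λ μ → ∣ s ∣ ≡ 1 × m ≡ s * (1ℤ + + μ)
nonzero-signed (+ zero)  m≢0 = contradiction refl m≢0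
nonzero-signed (+ suc μ) _   = 1ℤ , μ , refl , sym (*-identityˡ (+ suc μ))
nonzero-signed -[1+ μ ]  _   = -1ℤ , μ , refl , sym (-1*i≡-i (+ suc μ))

-- After multiplication by s the diagonal term becomes d s² = d, at least 4, and each of the four
-- other terms is at least -1.
dominant-diagonal : ∀ d s t₁ t₂ t₃ t₄ → + 4 ≤ d → ∣ s ∣ ≡ 1 →
  ∣ t₁ ∣ ℕ.≤ 1 → ∣ t₂ ∣ ℕ.≤ 1 → ∣ t₃ ∣ ℕ.≤ 1 → ∣ t₄ ∣ ℕ.≤ 1 →
  0ℤ ≤ s * (d * s + t₁ + t₂ + t₃ + t₄)
dominant-diagonal d s t₁ t₂ t₃ t₄ 4≤d ∣s∣≡1 p₁ p₂ p₃ p₄ = begin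
  + 4 + -1ℤ + -1ℤ + -1ℤ + -1ℤ
    ≤⟨ +-mono-≤ (+-mono-≤ (+-mono-≤ (+-mono-≤ 4≤d (off t₁ p₁)) (off t₂ p₂)) (off t₃ p₃)) (off t₄ p₄) ⟩
  d + s * t₁ + s * t₂ + s * t₃ + s * t₄
    ≡⟨ cong (λ e → e + s * t₁ + s * t₂ + s * t₃ + s * t₄)
         (trans (sym (*-identityʳ d)) (cong (d *_) (sym (unit-square s ∣s∣≡1)))) ⟩
  d * (s * s) + s * t₁ + s * t₂ + s * t₃ + s * t₄
    ≡⟨ lemma d s t₁ t₂ t₃ t₄ ⟩
  s * (d * s + t₁ + t₂ + t₃ + t₄) ∎
  where
  open ≤-Reasoning
  lemma : ∀ d s t₁ t₂ t₃ t₄ →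
    d * (s * s) + s * t₁ + s * t₂ + s * t₃ + s * t₄ ≡ s * (d * s + t₁ + t₂ + t₃ + t₄)
  lemma = solve-∀
  -1≤ : ∀ i → ∣ i ∣ ℕ.≤ 1 → -1ℤ ≤ i
  -1≤ (+ _)         _ = -≤+
  -1≤ -[1+ zero ]   _ = ≤-refl
  -1≤ -[1+ suc _ ] (ℕ.s≤s ())
  off : ∀ t → ∣ t ∣ ℕ.≤ 1 → -1ℤ ≤ s * t
  off t p = -1≤ (s * t) (subst (ℕ._≤ 1)
    (sym (trans (abs-* s t) (trans (cong (ℕ._* ∣ t ∣) ∣s∣≡1) (ℕ.*-identityˡ ∣ t ∣)))) p)

-- m R exceeds s R by μ copies of the nonnegative number s R. This is how the coefficients mᵢ are
-- compared with their signs sᵢ.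
multiple-≥ : ∀ {m} s R μ → m ≡ s * (1ℤ + + μ) → 0ℤ ≤ s * R → s * R ≤ m * R
multiple-≥ {m} s R μ m≡ 0≤sR = begin
  s * R                      ≡⟨ +-identityʳ (s * R) ⟨
  s * R + 0ℤ                 ≡⟨ cong (_+_ (s * R)) (*-zeroʳ (+ μ)) ⟨
  s * R + + μ * 0ℤ           ≤⟨ +-monoʳ-≤ (s * R) (*-monoˡ-≤-nonNeg (+ μ) 0≤sR) ⟩
  s * R + + μ * (s * R)      ≡⟨ lemma s R (+ μ) ⟩
  s * (1ℤ + + μ) * R         ≡⟨ cong (_* R) m≡ ⟨
  m * R                      ∎
  where
  open ≤-Reasoning
  lemma : ∀ s R μ → s * R + μ * (s * R) ≡ s * (1ℤ + μ) * R
  lemma = solve-∀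

-- All mᵢ supplied by `coordinates` have this form with the same p, so a single parity assumption
-- makes every one of them nonzero.
odd≢0 : ∀ {p} u → ¬ + 2 ∣ p → p + + 2 * u ≢ 0ℤ
odd≢0 {p} u odd eq = odd (divides (- u) (trans (lemma p u) (trans (cong (_+ - u * + 2) eq) (+-identityˡ _))))
  where
  lemma : ∀ p u → p ≡ p + + 2 * u + - u * + 2
  lemma = solve-∀

-- The hypothesis is 2w = Σ mᵢ Aᵢ tested against an arbitrary s.  The summands + 0 give every row the
-- shape of dominant-diagonal.
skew-form-bound : ∀ {a m₁ m₂ m₃ m₄ m₅ w₁ w₂ w₃ w₄ w₅} → 1ℤ ≤ a →
  m₁ ≢ 0ℤ → m₂ ≢ 0ℤ → m₃ ≢ 0ℤ → m₄ ≢ 0ℤ → m₅ ≢ 0ℤ →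
  (∀ s₁ s₂ s₃ s₄ s₅ →
    + 2 * (w₁ * s₁ + w₂ * s₂ + w₃ * s₃ + w₄ * s₄ + w₅ * s₅) ≡
    m₁ * (+ 4 * a * s₁ + s₂ + s₃ + s₄ + - s₅) +
    m₂ * ((+ 4 * a + + 1) * s₂ + - s₁ + s₄ + - s₅ + + 0) +
    m₃ * (+ 4 * a * s₃ + - s₁ + s₄ + + 0 + + 0) +
    m₄ * ((+ 4 * a + + 1) * s₄ + - s₁ + - s₂ + - s₃ + + 0) +
    m₅ * (+ 4 * a * s₅ + s₁ + s₂ + + 0 + + 0)) →
  + 10 * a + 1ℤ ≤ + ‖ w₁ ∷ w₂ ∷ w₃ ∷ w₄ ∷ w₅ ∷ [] ‖
skew-form-bound {a} {m₁} {m₂} {m₃} {m₄} {m₅} {w₁} {w₂} {w₃} {w₄} {w₅} 1≤a m₁≢0 m₂≢0 m₃≢0 m₄≢0 m₅≢0 2w≡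
  with s₁ , μ₁ , ∣s₁∣ , p₁ ← nonzero-signed m₁ m₁≢0
     | s₂ , μ₂ , ∣s₂∣ , p₂ ← nonzero-signed m₂ m₂≢0
     | s₃ , μ₃ , ∣s₃∣ , p₃ ← nonzero-signed m₃ m₃≢0
     | s₄ , μ₄ , ∣s₄∣ , p₄ ← nonzero-signed m₄ m₄≢0
     | s₅ , μ₅ , ∣s₅∣ , p₅ ← nonzero-signed m₅ m₅≢0 =
  *-cancelˡ-≤-pos _ _ (+ 2) (begin
    + 2 * (+ 10 * a + 1ℤ)
      -- The left side is the trace of A, since each sᵢ² will be 1.
      ≡⟨ trace a ⟩
    + 4 * a * 1ℤ + (+ 4 * a + 1ℤ) * 1ℤ + + 4 * a * 1ℤ + (+ 4 * a + 1ℤ) * 1ℤ + + 4 * a * 1ℤ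
      ≡⟨ cong₂ _+_ (cong₂ _+_ (cong₂ _+_ (cong₂ _+_
           (sq (+ 4 * a) s₁ ∣s₁∣) (sq (+ 4 * a + 1ℤ) s₂ ∣s₂∣)) (sq (+ 4 * a) s₃ ∣s₃∣))
           (sq (+ 4 * a + 1ℤ) s₄ ∣s₄∣)) (sq (+ 4 * a) s₅ ∣s₅∣) ⟩
    + 4 * a * (s₁ * s₁) + (+ 4 * a + 1ℤ) * (s₂ * s₂) + + 4 * a * (s₃ * s₃)
      + (+ 4 * a + 1ℤ) * (s₄ * s₄) + + 4 * a * (s₅ * s₅)
      ≡⟨ skew a s₁ s₂ s₃ s₄ s₅ ⟩
    s₁ * (+ 4 * a * s₁ + s₂ + s₃ + s₄ + - s₅) +
    s₂ * ((+ 4 * a + + 1) * s₂ + - s₁ + s₄ + - s₅ + + 0) +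
    s₃ * (+ 4 * a * s₃ + - s₁ + s₄ + + 0 + + 0) +
    s₄ * ((+ 4 * a + + 1) * s₄ + - s₁ + - s₂ + - s₃ + + 0) +
    s₅ * (+ 4 * a * s₅ + s₁ + s₂ + + 0 + + 0)
      -- The brackets are the rows of A applied to s. By diagonal dominance sᵢ times the i-th
      -- bracket is nonnegative, so replacing the factor sᵢ by mᵢ, which has the same sign, cannot
      -- decrease any summand.
      ≤⟨ +-mono-≤ (+-mono-≤ (+-mono-≤ (+-mono-≤
           (multiple-≥ s₁ _ μ₁ p₁ (dominant-diagonal (+ 4 * a) s₁ s₂ s₃ s₄ (- s₅) 4≤4a ∣s₁∣
             (unit s₂ ∣s₂∣) (unit s₃ ∣s₃∣) (unit s₄ ∣s₄∣) (unit⁻ s₅ ∣s₅∣)))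
           (multiple-≥ s₂ _ μ₂ p₂ (dominant-diagonal (+ 4 * a + 1ℤ) s₂ (- s₁) s₄ (- s₅) 0ℤ 4≤4a+1 ∣s₂∣
             (unit⁻ s₁ ∣s₁∣) (unit s₄ ∣s₄∣) (unit⁻ s₅ ∣s₅∣) ℕ.z≤n)))
           (multiple-≥ s₃ _ μ₃ p₃ (dominant-diagonal (+ 4 * a) s₃ (- s₁) s₄ 0ℤ 0ℤ 4≤4a ∣s₃∣
             (unit⁻ s₁ ∣s₁∣) (unit s₄ ∣s₄∣) ℕ.z≤n ℕ.z≤n)))
           (multiple-≥ s₄ _ μ₄ p₄ (dominant-diagonal (+ 4 * a + 1ℤ) s₄ (- s₁) (- s₂) (- s₃) 0ℤ 4≤4a+1 ∣s₄∣
             (unit⁻ s₁ ∣s₁∣) (unit⁻ s₂ ∣s₂∣) (unit⁻ s₃ ∣s₃∣) ℕ.z≤n)))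
           (multiple-≥ s₅ _ μ₅ p₅ (dominant-diagonal (+ 4 * a) s₅ s₁ s₂ 0ℤ 0ℤ 4≤4a ∣s₅∣
             (unit s₁ ∣s₁∣) (unit s₂ ∣s₂∣) ℕ.z≤n ℕ.z≤n)) ⟩
    m₁ * (+ 4 * a * s₁ + s₂ + s₃ + s₄ + - s₅) +
    m₂ * ((+ 4 * a + + 1) * s₂ + - s₁ + s₄ + - s₅ + + 0) +
    m₃ * (+ 4 * a * s₃ + - s₁ + s₄ + + 0 + + 0) +
    m₄ * ((+ 4 * a + + 1) * s₄ + - s₁ + - s₂ + - s₃ + + 0) +
    m₅ * (+ 4 * a * s₅ + s₁ + s₂ + + 0 + + 0)
      ≡⟨ 2w≡ s₁ s₂ s₃ s₄ s₅ ⟨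
    + 2 * (w₁ * s₁ + w₂ * s₂ + w₃ * s₃ + w₄ * s₄ + w₅ * s₅)
      ≤⟨ *-monoˡ-≤-nonNeg (+ 2) (+-mono-≤ (+-mono-≤ (+-mono-≤ (+-mono-≤
           (abs w₁ s₁ ∣s₁∣) (abs w₂ s₂ ∣s₂∣)) (abs w₃ s₃ ∣s₃∣)) (abs w₄ s₄ ∣s₄∣)) (abs w₅ s₅ ∣s₅∣)) ⟩
    + 2 * (+ ∣ w₁ ∣ + + ∣ w₂ ∣ + + ∣ w₃ ∣ + + ∣ w₄ ∣ + + ∣ w₅ ∣)
      ≡⟨ cong (+ 2 *_) (reassoc (+ ∣ w₁ ∣) (+ ∣ w₂ ∣) (+ ∣ w₃ ∣) (+ ∣ w₄ ∣) (+ ∣ w₅ ∣)) ⟩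
    + 2 * + ‖ w₁ ∷ w₂ ∷ w₃ ∷ w₄ ∷ w₅ ∷ [] ‖ ∎)
  where
  open ≤-Reasoning
  trace : ∀ a → + 2 * (+ 10 * a + 1ℤ) ≡
    + 4 * a * 1ℤ + (+ 4 * a + 1ℤ) * 1ℤ + + 4 * a * 1ℤ + (+ 4 * a + 1ℤ) * 1ℤ + + 4 * a * 1ℤ
  trace = solve-∀
  sq : ∀ d s → ∣ s ∣ ≡ 1 → d * 1ℤ ≡ d * (s * s)
  sq d s ∣s∣≡1 = cong (d *_) (sym (unit-square s ∣s∣≡1))
  skew : ∀ a s₁ s₂ s₃ s₄ s₅ →
    + 4 * a * (s₁ * s₁) + (+ 4 * a + 1ℤ) * (s₂ * s₂) + + 4 * a * (s₃ * s₃)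
      + (+ 4 * a + 1ℤ) * (s₄ * s₄) + + 4 * a * (s₅ * s₅) ≡
    s₁ * (+ 4 * a * s₁ + s₂ + s₃ + s₄ + - s₅) +
    s₂ * ((+ 4 * a + + 1) * s₂ + - s₁ + s₄ + - s₅ + + 0) +
    s₃ * (+ 4 * a * s₃ + - s₁ + s₄ + + 0 + + 0) +
    s₄ * ((+ 4 * a + + 1) * s₄ + - s₁ + - s₂ + - s₃ + + 0) +
    s₅ * (+ 4 * a * s₅ + s₁ + s₂ + + 0 + + 0)
  skew = solve-∀
  4≤4a : + 4 ≤ + 4 * a
  4≤4a = *-monoˡ-≤-nonNeg (+ 4) 1≤a
  4≤4a+1 : + 4 ≤ + 4 * a + 1ℤ
  4≤4a+1 = ≤-trans 4≤4a (i≤i+j (+ 4 * a) 1ℤ)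
  unit : ∀ s → ∣ s ∣ ≡ 1 → ∣ s ∣ ℕ.≤ 1
  unit s = ℕ.≤-reflexive
  unit⁻ : ∀ s → ∣ s ∣ ≡ 1 → ∣ - s ∣ ℕ.≤ 1
  unit⁻ s ∣s∣≡1 = ℕ.≤-reflexive (trans (∣-i∣≡∣i∣ s) ∣s∣≡1)
  abs : ∀ w s → ∣ s ∣ ≡ 1 → w * s ≤ + ∣ w ∣
  abs w s ∣s∣≡1 = subst (_≤ + ∣ w ∣) (*-comm s w) (signed≤∣x∣ s w ∣s∣≡1)
  reassoc : ∀ x₁ x₂ x₃ x₄ x₅ → x₁ + x₂ + x₃ + x₄ + x₅ ≡ x₁ + (x₂ + (x₃ + (x₄ + (x₅ + 0ℤ))))
  reassoc = solve-∀

-- Here w₁ is eliminated by means of w · g = q n, and mᵢ = q + w₄ + w₅ + 2uᵢ comes from the adjugate of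
-- A, whose determinant is 2n; so all mᵢ have the parity of q + w₄ + w₅.
abstract
  coordinates : ∀ a q w₂ w₃ w₄ w₅ → ∃ λ u₁ → ∃ λ u₂ → ∃ λ u₃ → ∃ λ u₄ → ∃ λ u₅ →
    ∀ s₁ s₂ s₃ s₄ s₅ →
    + 2 * ((q * (+ 1 + a * (+ 10 + a * (+ 64 + a * (+ 256 + a * (+ 256 + a * + 512)))))
         - w₂ * (+ 1 + a * (+ 12 + a * (+ 8 + a * + 32)))
         - w₃ * (a * (a * (+ 48 + a * (+ 32 + a * + 128))) - 1ℤ)
         - w₄ * (+ 2 + a * (+ 14 + a * (+ 64 + a * (+ 64 + a * + 128))))
         - w₅ * (+ 2 + a * (+ 30 + a * (+ 120 + a * (+ 128 + a * + 256))))) * s₁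
         + w₂ * s₂ + w₃ * s₃ + w₄ * s₄ + w₅ * s₅) ≡
    (q + w₄ + w₅ + + 2 * u₁) * (+ 4 * a * s₁ + s₂ + s₃ + s₄ + - s₅) +
    (q + w₄ + w₅ + + 2 * u₂) * ((+ 4 * a + + 1) * s₂ + - s₁ + s₄ + - s₅ + + 0) +
    (q + w₄ + w₅ + + 2 * u₃) * (+ 4 * a * s₃ + - s₁ + s₄ + + 0 + + 0) +
    (q + w₄ + w₅ + + 2 * u₄) * ((+ 4 * a + + 1) * s₄ + - s₁ + - s₂ + - s₃ + + 0) +
    (q + w₄ + w₅ + + 2 * u₅) * (+ 4 * a * s₅ + s₁ + s₂ + + 0 + + 0)
  coordinates a q w₂ w₃ w₄ w₅ =
    a * (+ 4 + a * (+ 32 + a * (+ 64 + a * + 128))) * q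
      - (+ 1 + a * (+ 2 + a * + 8)) * w₂ + (+ 1 - a * (+ 4 + a * (+ 8 + a * + 32))) * w₃
      - (+ 1 + a * (+ 8 + a * (+ 16 + a * + 32))) * w₄ - (+ 2 + a * (+ 14 + a * (+ 32 + a * + 64))) * w₅ ,
    - (+ 1 + a * (+ 2 + a * (+ 24 + a * + 32))) * q
      + (+ 1 + a * + 2) * w₂ + (a * (+ 4 + a * + 8) - + 1) * w₃
      + a * (+ 6 + a * + 8) * w₄ + a * (+ 12 + a * + 16) * w₅ ,
    - (+ 1 + a * (+ 6 + a * (+ 24 + a * + 32))) * q
      + (+ 1 + a * + 2) * w₂ + a * (+ 4 + a * + 8) * w₃
      + (+ 1 + a * (+ 6 + a * + 8)) * w₄ + (+ 2 + a * (+ 12 + a * + 16)) * w₅ ,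
    a * (+ 2 + a * (+ 8 - a * + 32)) * q
      + (a * + 2 - + 1) * w₂ + a * (a * + 8 - + 4) * w₃
      + (a * (a * + 8 - + 2) - + 1) * w₄ + (a * (a * + 16 - + 4) - + 2) * w₅ ,
    a * (+ 2 + a * (+ 8 + a * + 32)) * q
      - a * + 2 * w₂ - a * (a * + 8) * w₃
      - (+ 1 + a * (+ 2 + a * + 8)) * w₄ - (+ 1 + a * (+ 4 + a * + 16)) * w₅ ,
    λ s₁ s₂ s₃ s₄ s₅ → solve (a L.∷ q L.∷ w₂ L.∷ w₃ L.∷ w₄ L.∷ w₅ L.∷ s₁ L.∷ s₂ L.∷ s₃ L.∷ s₄ L.∷ s₅ L.∷ L.[])

opaque
  unfolding order otherGenerators

  -- As the first generator is 1, the equation determines w₁. Then `coordinates` writes 2w as Σ mᵢ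
  -- Aᵢ with all mᵢ congruent to q + w₄ + w₅ modulo 2, hence odd, and `skew-form-bound` applies.
  odd-norm : ∀ {a} q w₁ w₂ w₃ w₄ w₅ → 1ℤ ≤ a →
    (w₁ ∷ w₂ ∷ w₃ ∷ w₄ ∷ w₅ ∷ []) · generators a ≡ q * order a →
    ¬ + 2 ∣ q + w₄ + w₅ →
    + 10 * a + 1ℤ ≤ + ‖ w₁ ∷ w₂ ∷ w₃ ∷ w₄ ∷ w₅ ∷ [] ‖
  odd-norm {a} q w₁ w₂ w₃ w₄ w₅ 1≤a w∈L odd =
    let u₁ , u₂ , u₃ , u₄ , u₅ , 2w≡ = coordinates a q w₂ w₃ w₄ w₅ in
    skew-form-bound {w₁ = w₁} {w₂} {w₃} {w₄} {w₅} 1≤a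
      (odd≢0 u₁ odd) (odd≢0 u₂ odd) (odd≢0 u₃ odd) (odd≢0 u₄ odd) (odd≢0 u₅ odd)
      (λ s₁ s₂ s₃ s₄ s₅ → trans
        (cong (λ w → + 2 * (w * s₁ + w₂ * s₂ + w₃ * s₃ + w₄ * s₄ + w₅ * s₅))
          (isolate w₁ _ _ _ _ w∈L))
        (2w≡ s₁ s₂ s₃ s₄ s₅))
    where
    isolate : ∀ w₁ x₂ x₃ x₄ x₅ {N} → w₁ * 1ℤ + (x₂ + (x₃ + (x₄ + (x₅ + 0ℤ)))) ≡ N →
      w₁ ≡ N - x₂ - x₃ - x₄ - x₅
    isolate w₁ x₂ x₃ x₄ x₅ refl = lemma w₁ x₂ x₃ x₄ x₅
      where
      lemma : ∀ w₁ x₂ x₃ x₄ x₅ →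
        w₁ ≡ w₁ * 1ℤ + (x₂ + (x₃ + (x₄ + (x₅ + 0ℤ)))) - x₂ - x₃ - x₄ - x₅
      lemma = solve-∀

-- With a = 1 + b, the sum of near and far is ½ Σ Aᵢ.
near far : ℤ → Vec ℤ 5
near b = 1ℤ + (b + b) ∷ + 3 + (b + b) ∷ 1ℤ + b ∷ 0ℤ ∷ 0ℤ ∷ []
far  b = 0ℤ ∷ 0ℤ ∷ 1ℤ + b ∷ + 4 + (b + b) ∷ 1ℤ + (b + b) ∷ []

opaque
  unfolding order otherGenerators

  near+far∈L : ∀ b → near b · generators (1ℤ + b) + far b · generators (1ℤ + b) ≡ + 2 * order (1ℤ + b)
  near+far∈L = lemma
    where
    lemma : ∀ b → let a = + 1 + b in
      ((+ 1 + (b + b)) * + 1 + ((+ 3 + (b + b)) * (+ 1 + a * (+ 12 + a * (+ 8 + a * + 32))) +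
        ((+ 1 + b) * (a * (a * (+ 48 + a * (+ 32 + a * + 128))) - + 1) +
        (+ 0 * (+ 2 + a * (+ 14 + a * (+ 64 + a * (+ 64 + a * + 128)))) +
        (+ 0 * (+ 2 + a * (+ 30 + a * (+ 120 + a * (+ 128 + a * + 256)))) + + 0)))))
      + (+ 0 * + 1 + (+ 0 * (+ 1 + a * (+ 12 + a * (+ 8 + a * + 32))) +
        ((+ 1 + b) * (a * (a * (+ 48 + a * (+ 32 + a * + 128))) - + 1) +
        ((+ 4 + (b + b)) * (+ 2 + a * (+ 14 + a * (+ 64 + a * (+ 64 + a * + 128)))) +
        ((+ 1 + (b + b)) * (+ 2 + a * (+ 30 + a * (+ 120 + a * (+ 128 + a * + 256)))) + + 0)))))
      ≡ + 2 * (+ 1 + a * (+ 10 + a * (+ 64 + a * (+ 256 + a * (+ 256 + a * + 512)))))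
    lemma = solve-∀

‖near‖ : ∀ b → ‖ near (+ b) ‖ ≡ suc b ℕ.* 5
‖near‖ = lemma
  where
  lemma : ∀ b → (1 ℕ.+ (b ℕ.+ b)) ℕ.+ ((3 ℕ.+ (b ℕ.+ b)) ℕ.+ ((1 ℕ.+ b) ℕ.+ 0)) ≡ (1 ℕ.+ b) ℕ.* 5
  lemma = ℕ.solve-∀

‖far‖ : ∀ b → ‖ far (+ b) ‖ ≡ suc (suc b ℕ.* 5)
‖far‖ = lemma
  where
  lemma : ∀ b → (1 ℕ.+ b) ℕ.+ ((4 ℕ.+ (b ℕ.+ b)) ℕ.+ ((1 ℕ.+ (b ℕ.+ b)) ℕ.+ 0)) ≡ 1 ℕ.+ ((1 ℕ.+ b) ℕ.* 5)
  lemma = ℕ.solve-∀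

odd-norm-ℕ : ∀ b q w₁ w₂ w₃ w₄ w₅ →
  (w₁ ∷ w₂ ∷ w₃ ∷ w₄ ∷ w₅ ∷ []) · generators (1ℤ + + b) ≡ q * order (1ℤ + + b) →
  ¬ + 2 ∣ q + w₄ + w₅ →
  suc (suc b ℕ.* 5 ℕ.+ suc b ℕ.* 5) ℕ.≤ ‖ w₁ ∷ w₂ ∷ w₃ ∷ w₄ ∷ w₅ ∷ [] ‖
odd-norm-ℕ b q w₁ w₂ w₃ w₄ w₅ w∈L odd =
  drop‿+≤+ (≤-trans (≤-reflexive ten) (odd-norm q w₁ w₂ w₃ w₄ w₅ (+≤+ (ℕ.s≤s ℕ.z≤n)) w∈L odd))
  where
  lemma : ∀ x → + 1 + (x * + 5 + x * + 5) ≡ + 10 * x + + 1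
  lemma = solve-∀
  ten : + suc (suc b ℕ.* 5 ℕ.+ suc b ℕ.* 5) ≡ + 10 * (1ℤ + + b) + 1ℤ
  ten = trans (cong (λ z → + 1 + (z + z)) (pos-* (suc b) 5)) (lemma (1ℤ + + b))

-- The lower bound on the diameter

module LowerBound (b n : ℕ) (gs : Vec ℤ 5)
  (near+far∈L : near (+ b) · gs + far (+ b) · gs ≡ + 2 * + n)
  (odd-norm : ∀ q w₁ w₂ w₃ w₄ w₅ →
    (w₁ ∷ w₂ ∷ w₃ ∷ w₄ ∷ w₅ ∷ []) · gs ≡ q * + n → ¬ + 2 ∣ q + w₄ + w₅ →
    suc (suc b ℕ.* 5 ℕ.+ suc b ℕ.* 5) ℕ.≤ ‖ w₁ ∷ w₂ ∷ w₃ ∷ w₄ ∷ w₅ ∷ [] ‖) where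

  private
    x z : Vec ℤ 5
    x = near (+ b)
    z = far (+ b)

    distrib : ∀ p q n → p * n - q * n ≡ (p - q) * n
    distrib = solve-∀

  module _ (y : Vec ℤ 5) (v q₁ q₂ : ℤ) (eq₁ : v - y · gs ≡ q₁ * + n) (eq₂ : v - x · gs ≡ q₂ * + n) where

    x-y∈L : (x ⊟ y) · gs ≡ (q₁ - q₂) * + n
    x-y∈L = begin
      (x ⊟ y) · gs                   ≡⟨ ⊟-· x y gs ⟩
      x · gs - y · gs                ≡⟨ lemma v (x · gs) (y · gs) ⟩
      (v - y · gs) - (v - x · gs)    ≡⟨ cong₂ _-_ eq₁ eq₂ ⟩
      q₁ * + n - q₂ * + n            ≡⟨ distrib q₁ q₂ (+ n) ⟩
      (q₁ - q₂) * + n                ∎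
      where
      open ≡-Reasoning
      lemma : ∀ v x y → x - y ≡ (v - y) - (v - x)
      lemma = solve-∀

    -- Because z + y = (x + z) - (x - y), and x + z = ½ Σ Aᵢ has quotient 2.
    z+y∈L : (z ⊞ y) · gs ≡ (+ 2 - (q₁ - q₂)) * + n
    z+y∈L = begin
      (z ⊞ y) · gs                             ≡⟨ ⊞-· z y gs ⟩
      z · gs + y · gs                          ≡⟨ lemma (z · gs) (x · gs) (y · gs) ⟩
      (x · gs + z · gs) - (x · gs - y · gs)    ≡⟨ cong₂ _-_ near+far∈L (sym (⊟-· x y gs)) ⟩
      + 2 * + n - (x ⊟ y) · gs                 ≡⟨ cong (_-_ (+ 2 * + n)) x-y∈L ⟩
      + 2 * + n - (q₁ - q₂) * + n              ≡⟨ distrib (+ 2) (q₁ - q₂) (+ n) ⟩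
      (+ 2 - (q₁ - q₂)) * + n                  ∎
      where
      open ≡-Reasoning
      lemma : ∀ x z y → x + y ≡ (z + x) - (z - y)
      lemma = solve-∀

  -- The walk gives a vector y congruent to x = `near`. The lattice vectors x - y and z + y add up
  -- to the odd vector ½ Σ Aᵢ, so one of them is odd and has norm at least 2k + 1. Since ‖x‖ = k and
  -- ‖z‖ = k + 1, the triangle inequality gives ‖y‖ ≥ k in both cases.
  far-walk : ∀ {ℓ} (i j : Fin n) → Displacement n gs (x · gs) i j → Walk n gs ℓ i j → suc b ℕ.* 5 ℕ.≤ ℓ
  far-walk {ℓ} i j d w
    with y@(y₁ ∷ y₂ ∷ y₃ ∷ y₄ ∷ y₅ ∷ []) , ‖y‖≤ℓ , divides q₁ eq₁ ← walk⇒vector n gs w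
       | divides q₂ eq₂ ← d
    -- The parity of x - y: its quotient plus its last two entries, where `near` is 0.
    with + 2 ∣? (q₁ - q₂) + (0ℤ - y₄) + (0ℤ - y₅)
  ... | no odd = ℕ.+-cancelˡ-≤ (suc b ℕ.* 5) _ _ (ℕ.≤-trans (ℕ.n≤1+n _) (ℕ.≤-trans
          (odd-norm (q₁ - q₂) _ _ _ _ _ (x-y∈L y (+ toℕ j - + toℕ i) q₁ q₂ eq₁ eq₂) odd)
          (ℕ.≤-trans (‖zipWith‖≤ _-_ ∣i-j∣≤∣i∣+∣j∣ x y) (ℕ.+-mono-≤ (ℕ.≤-reflexive (‖near‖ b)) ‖y‖≤ℓ))))
  ... | yes even = ℕ.+-cancelˡ-≤ (suc (suc b ℕ.* 5)) _ _ (ℕ.≤-trans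
          (odd-norm (+ 2 - (q₁ - q₂)) _ _ _ _ _ (z+y∈L y (+ toℕ j - + toℕ i) q₁ q₂ eq₁ eq₂) (odd even))
          (ℕ.≤-trans (‖zipWith‖≤ _+_ ∣i+j∣≤∣i∣+∣j∣ z y) (ℕ.+-mono-≤ (ℕ.≤-reflexive (‖far‖ b)) ‖y‖≤ℓ)))
    where
    -- The parity expressions of x - y and z + y add up to 4b + 7. If the first is 2t, the second is
    -- therefore 1 plus twice 2b + 3 - t.
    parity : ∀ b q y₄ y₅ t → q + (0ℤ - y₄) + (0ℤ - y₅) ≡ t * + 2 →
      (+ 2 - q) + (+ 4 + (b + b) + y₄) + (+ 1 + (b + b) + y₅) - (+ 2 * b + + 3 - t) * + 2 ≡ 1ℤ
    parity b q y₄ y₅ t p = trans (lemma b q y₄ y₅ t)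
      (trans (cong (λ u → 1ℤ - (u - t * + 2)) p) (cancel (t * + 2)))
      where
      lemma : ∀ b q y₄ y₅ t →
        (+ 2 - q) + (+ 4 + (b + b) + y₄) + (+ 1 + (b + b) + y₅) - (+ 2 * b + + 3 - t) * + 2
          ≡ + 1 - (q + (+ 0 - y₄) + (+ 0 - y₅) - t * + 2)
      lemma = solve-∀
      cancel : ∀ u → + 1 - (u - u) ≡ + 1
      cancel = solve-∀
    odd : + 2 ∣ (q₁ - q₂) + (0ℤ - y₄) + (0ℤ - y₅) →
      ¬ + 2 ∣ (+ 2 - (q₁ - q₂)) + (+ (4 ℕ.+ (b ℕ.+ b)) + y₄) + (+ (1 ℕ.+ (b ℕ.+ b)) + y₅)
    odd (divides t p) even′ = 2∤1 (∣⇒∣ᵤ (subst (+ 2 ∣_) (parity (+ b) (q₁ - q₂) y₄ y₅ t p)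
      (∣m∣n⇒∣m-n even′ (divides (+ 2 * + b + + 3 - t) refl))))
      where
      2∤1 : ¬ 2 ℕ.∣ 1
      2∤1 = ℕ.>⇒∤ (ℕ.s≤s (ℕ.s≤s ℕ.z≤n))

-- Certificates for the upper bound

infix 6 _a+_
-- Box bounds, thresholds and lattice vectors all depend affinely on the parameter. Storing the two
-- coefficients lets one Boolean computation cover infinitely many values of a.
record Affine : Set where
  constructor _a+_
  field
    slope offset : ℤ

⟦_⟧ : Affine → ℤ → ℤ
⟦ p a+ q ⟧ a = p * a + q

infixl 5 _⊕_ _⊝_
infixr 6 _⊛_
-- ⊔ᴬ and absᴬ only give upper bounds for the maximum and the absolute value, valid where the
-- parameter is nonnegative.
_⊕_ _⊝_ _⊔ᴬ_ : Affine → Affine → Affine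
(p a+ q) ⊕ (p′ a+ q′) = (p + p′) a+ (q + q′)
(p a+ q) ⊝ (p′ a+ q′) = (p - p′) a+ (q - q′)
(p a+ q) ⊔ᴬ (p′ a+ q′) = (p ⊔ p′) a+ (q ⊔ q′)

_⊛_ : ℤ → Affine → Affine
c ⊛ (p a+ q) = (c * p) a+ (c * q)

absᴬ : Affine → Affine
absᴬ (p a+ q) = (+ ∣ p ∣) a+ (+ ∣ q ∣)

-- Comparing coefficients is sufficient for the inequality at all natural arguments, but not
-- necessary; `rebase` makes it sharper by moving the start of the range of a to argument 0.
_≤ᴬ_ : Affine → Affine → Bool
(p a+ q) ≤ᴬ (p′ a+ q′) = (p ≤ᵇ p′) ∧ (q ≤ᵇ q′)

⟦⊕⟧ : ∀ l m a → ⟦ l ⊕ m ⟧ a ≡ ⟦ l ⟧ a + ⟦ m ⟧ a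
⟦⊕⟧ (p a+ q) (p′ a+ q′) = lemma p q p′ q′
  where
  lemma : ∀ p q p′ q′ a → (p + p′) * a + (q + q′) ≡ p * a + q + (p′ * a + q′)
  lemma = solve-∀

⟦⊝⟧ : ∀ l m a → ⟦ l ⊝ m ⟧ a ≡ ⟦ l ⟧ a - ⟦ m ⟧ a
⟦⊝⟧ (p a+ q) (p′ a+ q′) = lemma p q p′ q′
  where
  lemma : ∀ p q p′ q′ a → (p - p′) * a + (q - q′) ≡ p * a + q - (p′ * a + q′)
  lemma = solve-∀

⟦⊛⟧ : ∀ c l a → ⟦ c ⊛ l ⟧ a ≡ c * ⟦ l ⟧ a
⟦⊛⟧ c (p a+ q) = lemma c p q
  where
  lemma : ∀ c p q a → c * p * a + c * q ≡ c * (p * a + q)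
  lemma = solve-∀

⟦⟧-mono : ∀ {p q p′ q′} b → p ≤ p′ → q ≤ q′ → ⟦ p a+ q ⟧ (+ b) ≤ ⟦ p′ a+ q′ ⟧ (+ b)
⟦⟧-mono b p≤p′ q≤q′ = +-mono-≤ (*-monoʳ-≤-nonNeg (+ b) p≤p′) q≤q′

≤ᴬ-sound : ∀ l m → T (l ≤ᴬ m) → ∀ b → ⟦ l ⟧ (+ b) ≤ ⟦ m ⟧ (+ b)
≤ᴬ-sound (p a+ q) (p′ a+ q′) t b with t₁ , t₂ ← Equivalence.to (T-∧ {p ≤ᵇ p′}) t =
  ⟦⟧-mono {p} {q} {p′} {q′} b (≤ᵇ⇒≤ t₁) (≤ᵇ⇒≤ t₂)

⟦⟧≤⊔ˡ : ∀ l m b → ⟦ l ⟧ (+ b) ≤ ⟦ l ⊔ᴬ m ⟧ (+ b)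
⟦⟧≤⊔ˡ (p a+ q) (p′ a+ q′) b = ⟦⟧-mono b (i≤i⊔j p p′) (i≤i⊔j q q′)

⟦⟧≤⊔ʳ : ∀ l m b → ⟦ m ⟧ (+ b) ≤ ⟦ l ⊔ᴬ m ⟧ (+ b)
⟦⟧≤⊔ʳ (p a+ q) (p′ a+ q′) b = ⟦⟧-mono b (i≤j⊔i p p′) (i≤j⊔i q q′)

∣⟦⟧∣≤ : ∀ l b → + ∣ ⟦ l ⟧ (+ b) ∣ ≤ ⟦ absᴬ l ⟧ (+ b)
∣⟦⟧∣≤ (p a+ q) b = begin
  + ∣ p * + b + q ∣               ≤⟨ +≤+ (∣i+j∣≤∣i∣+∣j∣ (p * + b) q) ⟩
  + ∣ p * + b ∣ + + ∣ q ∣         ≡⟨ cong (λ n → + n + + ∣ q ∣) (abs-* p (+ b)) ⟩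
  + (∣ p ∣ ℕ.* b) + + ∣ q ∣       ≡⟨ cong (_+ + ∣ q ∣) (pos-* ∣ p ∣ b) ⟩
  + ∣ p ∣ * + b + + ∣ q ∣         ∎
  where open ≤-Reasoning

Box : ℕ → Set
Box r = Vec (Affine × Affine) r

infix 4 _∈_at_
_∈_at_ : ∀ {r} → Vec ℤ r → Box r → ℤ → Set
[]       ∈ []              at a = ⊤
(x ∷ xs) ∈ (lo , hi) ∷ box at a = (⟦ lo ⟧ a ≤ x × x ≤ ⟦ hi ⟧ a) × xs ∈ box at a

-- Over ℤ the negation of x ≤ θ is θ + 1 ≤ x. The old bound is overwritten instead of intersected
-- with, because affine bounds need not be comparable.
below above : ∀ {r} → Fin r → Affine → Box r → Box r
below i θ box = updateAt box i (map₂ (λ _ → θ))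
above i θ box = updateAt box i (map₁ (λ _ → θ ⊕ (0ℤ a+ 1ℤ)))

∈-below : ∀ {r} i θ {x : Vec ℤ r} {box a} →
  x ∈ box at a → lookup x i ≤ ⟦ θ ⟧ a → x ∈ below i θ box at a
∈-below Fin.zero    θ {x ∷ xs} {_ ∷ box} ((p , _) , ps) le = (p , le) , ps
∈-below (Fin.suc i) θ {x ∷ xs} {_ ∷ box} (p , ps)       le = p , ∈-below i θ ps le

∈-above : ∀ {r} i θ {x : Vec ℤ r} {box a} →
  x ∈ box at a → ¬ lookup x i ≤ ⟦ θ ⟧ a → x ∈ above i θ box at a
∈-above Fin.zero    θ {x ∷ xs} {_ ∷ box} {a} ((_ , q) , ps) ≰ =
  (subst (_≤ x) (trans (+-comm 1ℤ (⟦ θ ⟧ a)) (sym (⟦⊕⟧ θ (0ℤ a+ 1ℤ) a))) (i<j⇒suc[i]≤j (≰⇒> ≰)) , q) , ps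
∈-above (Fin.suc i) θ {x ∷ xs} {_ ∷ box} (p , ps)       ≰ = p , ∈-above i θ ps ≰

⟦_⟧ᵛ : ∀ {r} → Vec Affine r → ℤ → Vec ℤ r
⟦ ls ⟧ᵛ a = map (λ l → ⟦ l ⟧ a) ls

combine : ∀ {r s} → Vec ℤ s → Vec (Vec Affine r) s → Vec Affine r
combine []       []       = replicate _ (0ℤ a+ 0ℤ)
combine (c ∷ cs) (v ∷ vs) = zipWith (λ l m → c ⊛ l ⊕ m) v (combine cs vs)

combine-∣ : ∀ {r s} n a (gs : Vec ℤ r) (cs : Vec ℤ s) vs →
  All (λ v → n ∣ ⟦ v ⟧ᵛ a · gs) vs → n ∣ ⟦ combine cs vs ⟧ᵛ a · gs
combine-∣ n a gs []       []       []       = subst (n ∣_) (sym (zero-· gs)) (divides 0ℤ refl)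
  where
  zero-· : ∀ {r} (gs : Vec ℤ r) → ⟦ replicate r (0ℤ a+ 0ℤ) ⟧ᵛ a · gs ≡ 0ℤ
  zero-· []       = refl
  zero-· (g ∷ gs) = trans (+-identityˡ _) (zero-· gs)
combine-∣ n a gs (c ∷ cs) (v ∷ vs) (p ∷ ps) =
  subst (n ∣_) (sym (axpy v (combine cs vs) gs)) (∣m∣n⇒∣m+n (∣n⇒∣m*n c p) (combine-∣ n a gs cs vs ps))
  where
  lemma : ∀ c l m g p q → (c * l + m) * g + (c * p + q) ≡ c * (l * g + p) + (m * g + q)
  lemma = solve-∀
  axpy : ∀ {r} (ls ms : Vec Affine r) (gs : Vec ℤ r) →
    ⟦ zipWith (λ l m → c ⊛ l ⊕ m) ls ms ⟧ᵛ a · gs ≡ c * ⟦ ls ⟧ᵛ a · gs + ⟦ ms ⟧ᵛ a · gs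
  axpy []       []       []       = sym (trans (+-identityʳ (c * 0ℤ)) (*-zeroʳ c))
  axpy (l ∷ ls) (m ∷ ms) (g ∷ gs)
    rewrite axpy ls ms gs | ⟦⊕⟧ (c ⊛ l) m a | ⟦⊛⟧ c l a =
    lemma c (⟦ l ⟧ a) (⟦ m ⟧ a) g (⟦ ls ⟧ᵛ a · gs) (⟦ ms ⟧ᵛ a · gs)

infix 3 _or_
-- A leaf names the lattice vector to subtract by its coefficients in the basis. An `or` offers two
-- candidates on the same box, so that one tree can serve several progressions of a.
data Tree (r s : ℕ) : Set where
  leaf  : Vec ℤ s → Tree r s
  split : Fin r → Affine → Tree r s → Tree r s → Tree r s
  _or_  : Tree r s → Tree r s → Tree r s

-- α and β restrict a to the progression α b + β with b a natural number.
module _ (α β : ℤ) where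

  rebase : Affine → Affine
  rebase (p a+ q) = (p * α) a+ (p * β + q)

  ⟦rebase⟧ : ∀ l b → ⟦ rebase l ⟧ b ≡ ⟦ l ⟧ (α * b + β)
  ⟦rebase⟧ (p a+ q) b = lemma α β p q b
    where
    lemma : ∀ α β p q b → p * α * b + (p * β + q) ≡ p * (α * b + β) + q
    lemma = solve-∀

  -- y ↦ ∣ y - w ∣ + d * y is convex, so on an interval it is bounded by its values at the endpoints.
  endpointValue : ℤ → Affine → Affine → Affine
  endpointValue d w y = absᴬ (rebase (y ⊝ w)) ⊕ rebase (d ⊛ y)

  -- ‖x - w‖ + c (ss · x) is a sum of functions of one coordinate each, and each summand is bounded
  -- on its own interval.
  distanceBound : ∀ {r} → ℤ → Vec ℤ r → Vec Affine r → Box r → Affine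
  distanceBound c []       []       []                = 0ℤ a+ 0ℤ
  distanceBound c (s ∷ ss) (w ∷ ws) ((lo , hi) ∷ box) =
    (endpointValue (c * s) w lo ⊔ᴬ endpointValue (c * s) w hi) ⊕ distanceBound c ss ws box

  module _ (b : ℕ) where

    private
      a : ℤ
      a = α * + b + β

    endpointValue-sound : ∀ d w y →
      + ∣ ⟦ y ⟧ a - ⟦ w ⟧ a ∣ + d * ⟦ y ⟧ a ≤ ⟦ endpointValue d w y ⟧ (+ b)
    endpointValue-sound d w y = begin
      + ∣ ⟦ y ⟧ a - ⟦ w ⟧ a ∣ + d * ⟦ y ⟧ a
        ≡⟨ cong₂ (λ u v → + ∣ u ∣ + v) (sym (trans (⟦rebase⟧ (y ⊝ w) (+ b)) (⟦⊝⟧ y w a)))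
                 (sym (trans (⟦rebase⟧ (d ⊛ y) (+ b)) (⟦⊛⟧ d y a))) ⟩
      + ∣ ⟦ rebase (y ⊝ w) ⟧ (+ b) ∣ + ⟦ rebase (d ⊛ y) ⟧ (+ b)
        ≤⟨ +-monoˡ-≤ _ (∣⟦⟧∣≤ (rebase (y ⊝ w)) b) ⟩
      ⟦ absᴬ (rebase (y ⊝ w)) ⟧ (+ b) + ⟦ rebase (d ⊛ y) ⟧ (+ b)
        ≡⟨ ⟦⊕⟧ (absᴬ (rebase (y ⊝ w))) (rebase (d ⊛ y)) (+ b) ⟨
      ⟦ endpointValue d w y ⟧ (+ b) ∎
      where open ≤-Reasoning

    distanceBound-sound : ∀ {r} c (ss : Vec ℤ r) ws box x → x ∈ box at a →
      + ‖ x ⊟ ⟦ ws ⟧ᵛ a ‖ + c * (ss · x) ≤ ⟦ distanceBound c ss ws box ⟧ (+ b)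
    distanceBound-sound c []       []       []                []       _ =
      ≤-reflexive (trans (+-identityˡ (c * 0ℤ)) (*-zeroʳ c))
    distanceBound-sound c (s ∷ ss) (w ∷ ws) ((lo , hi) ∷ box) (x ∷ xs) ((lo≤x , x≤hi) , xs∈) = begin
      + ∣ x - ⟦ w ⟧ a ∣ + + ‖ xs ⊟ ⟦ ws ⟧ᵛ a ‖ + c * (s * x + ss · xs)
        ≡⟨ lemma (+ ∣ x - ⟦ w ⟧ a ∣) (+ ‖ xs ⊟ ⟦ ws ⟧ᵛ a ‖) c s x (ss · xs) ⟩
      (+ ∣ x - ⟦ w ⟧ a ∣ + c * s * x) + (+ ‖ xs ⊟ ⟦ ws ⟧ᵛ a ‖ + c * (ss · xs))
        ≤⟨ +-mono-≤
             (convex-≤-endpoint (c * s) (⟦ w ⟧ a) (⟦ el ⊔ᴬ eh ⟧ (+ b)) lo≤x x≤hi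
               (≤-trans (endpointValue-sound (c * s) w lo) (⟦⟧≤⊔ˡ el eh b))
               (≤-trans (endpointValue-sound (c * s) w hi) (⟦⟧≤⊔ʳ el eh b)))
             (distanceBound-sound c ss ws box xs xs∈) ⟩
      ⟦ el ⊔ᴬ eh ⟧ (+ b) + ⟦ distanceBound c ss ws box ⟧ (+ b)
        ≡⟨ ⟦⊕⟧ (el ⊔ᴬ eh) (distanceBound c ss ws box) (+ b) ⟨
      ⟦ distanceBound c (s ∷ ss) (w ∷ ws) ((lo , hi) ∷ box) ⟧ (+ b) ∎
      where
      open ≤-Reasoning
      el = endpointValue (c * s) w lo
      eh = endpointValue (c * s) w hi
      lemma : ∀ d e c s x p → d + e + c * (s * x + p) ≡ (d + c * s * x) + (e + c * p)
      lemma = solve-∀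

  module _ {r s : ℕ} (basis : Vec (Vec Affine r) s) (radius : Affine) where

    -- ss is the sign vector of the orthant, so ss · x = ‖ x ‖ = radius + 1, and c is a multiplier for
    -- this equation: the bound is on ‖ x - w ‖ + c (ss · x).
    fits : Vec ℤ r → Box r → ℤ → Vec ℤ s → Bool
    fits ss box c cs =
      distanceBound c ss (combine cs basis) box ≤ᴬ rebase (radius ⊕ c ⊛ (radius ⊕ (0ℤ a+ 1ℤ)))

    check : Vec ℤ r → Box r → Tree r s → Bool
    -- With c = -1 the claim is ‖x - w‖ - ‖x‖ ≤ -1, which suits vectors that shorten x. With c = 1
    -- it is ‖x - w‖ + ‖x‖ ≤ 2k + 1, which suits x in the box spanned by a w of norm 2k + 1. With c
    -- = 0 the box alone has to give ‖x - w‖ ≤ k.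
    check ss box (leaf cs)       = fits ss box -1ℤ cs ∨ (fits ss box 1ℤ cs ∨ fits ss box 0ℤ cs)
    check ss box (split i θ l u) = check ss (below i θ box) l ∧ check ss (above i θ box) u
    check ss box (l or u)        = check ss box l ∨ check ss box u

    module _ (b : ℕ) where

      private
        a : ℤ
        a = α * + b + β

      Reducible : Vec ℤ r → Set
      Reducible x = ∃ λ cs → + ‖ x ⊟ ⟦ combine cs basis ⟧ᵛ a ‖ ≤ ⟦ radius ⟧ a

      module _ (ss x : Vec ℤ r) (‖x‖ : ss · x ≡ ⟦ radius ⟧ a + 1ℤ) where

        fits-sound : ∀ box c cs → T (fits ss box c cs) → x ∈ box at a → Reducible x
        fits-sound box c cs t x∈ = cs , (begin
          + ‖ y ‖                                                 ≡⟨ add (+ ‖ y ‖) (c * (ss · x)) ⟩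
          + ‖ y ‖ + c * (ss · x) - c * (ss · x)
            ≤⟨ +-monoˡ-≤ _ (≤-trans (distanceBound-sound b c ss (combine cs basis) box x x∈)
                                    (≤ᴬ-sound (distanceBound c ss (combine cs basis) box) (rebase bound) t b)) ⟩
          ⟦ rebase bound ⟧ (+ b) - c * (ss · x)
            ≡⟨ cong₂ _-_ (trans (⟦rebase⟧ bound (+ b)) ⟦bound⟧) (cong (c *_) ‖x‖) ⟩
          ⟦ radius ⟧ a + c * (⟦ radius ⟧ a + 1ℤ) - c * (⟦ radius ⟧ a + 1ℤ)
            ≡⟨ add (⟦ radius ⟧ a) _ ⟨
          ⟦ radius ⟧ a                                            ∎)
          where
          open ≤-Reasoning
          y = x ⊟ ⟦ combine cs basis ⟧ᵛ a
          bound = radius ⊕ c ⊛ (radius ⊕ (0ℤ a+ 1ℤ))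
          ⟦bound⟧ : ⟦ bound ⟧ a ≡ ⟦ radius ⟧ a + c * (⟦ radius ⟧ a + 1ℤ)
          ⟦bound⟧ = trans (⟦⊕⟧ radius (c ⊛ (radius ⊕ (0ℤ a+ 1ℤ))) a) (cong (_+_ (⟦ radius ⟧ a))
            (trans (⟦⊛⟧ c (radius ⊕ (0ℤ a+ 1ℤ)) a) (cong (c *_) (⟦⊕⟧ radius (0ℤ a+ 1ℤ) a))))
          add : ∀ u v → u ≡ u + v - v
          add = solve-∀

        check-sound : ∀ box tree → T (check ss box tree) → x ∈ box at a → Reducible x
        check-sound box (leaf cs) t x∈ with Equivalence.to (T-∨ {fits ss box -1ℤ cs}) t
        ... | inj₁ t₁ = fits-sound box -1ℤ cs t₁ x∈
        ... | inj₂ t₂ with Equivalence.to (T-∨ {fits ss box 1ℤ cs}) t₂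
        ...   | inj₁ t₃ = fits-sound box 1ℤ cs t₃ x∈
        ...   | inj₂ t₃ = fits-sound box 0ℤ cs t₃ x∈
        check-sound box (split i θ l u) t x∈
          with tₗ , tᵤ ← Equivalence.to (T-∧ {check ss (below i θ box) l}) t | lookup x i ≤? ⟦ θ ⟧ a
        ... | yes le = check-sound (below i θ box) l tₗ (∈-below i θ x∈ le)
        ... | no ≰ = check-sound (above i θ box) u tᵤ (∈-above i θ x∈ ≰)
        check-sound box (l or u)        t x∈ with Equivalence.to (T-∨ {check ss box l}) t
        ... | inj₁ t₁ = check-sound box l t₁ x∈
        ... | inj₂ t₂ = check-sound box u t₂ x∈

-- The lattice basis and the decision trees

const 2a+ -2a+ 4a+ : ℤ → Affine
const q = 0ℤ a+ q
2a+ q   = (+ 2) a+ q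
-2a+ q  = (- + 2) a+ q
4a+ q   = (+ 4) a+ q

-- ½ Σ Aᵢ followed by A₁, …, A₅.
basis : Vec (Vec Affine 5) 6
basis =
  (2a+ -1ℤ    ∷ 2a+ 1ℤ    ∷ 2a+ 0ℤ    ∷ 2a+ (+ 2) ∷ 2a+ -1ℤ   ∷ []) ∷
  (4a+ 0ℤ     ∷ const 1ℤ  ∷ const 1ℤ  ∷ const 1ℤ  ∷ const -1ℤ ∷ []) ∷
  (const -1ℤ  ∷ 4a+ 1ℤ    ∷ const 0ℤ  ∷ const 1ℤ  ∷ const -1ℤ ∷ []) ∷
  (const -1ℤ  ∷ const 0ℤ  ∷ 4a+ 0ℤ    ∷ const 1ℤ  ∷ const 0ℤ  ∷ []) ∷
  (const -1ℤ  ∷ const -1ℤ ∷ const -1ℤ ∷ 4a+ 1ℤ    ∷ const 0ℤ  ∷ []) ∷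
  (const 1ℤ   ∷ const 1ℤ  ∷ const 0ℤ  ∷ const 0ℤ  ∷ 4a+ 0ℤ    ∷ []) ∷ []

opaque
  unfolding order otherGenerators

  basis∈L : ∀ a → All (λ v → order a ∣ ⟦ v ⟧ᵛ a · generators a) basis
  basis∈L a =
    divides (+ 2) (f∈L a) ∷ divides (+ 0) (A₁∈L a) ∷ divides (+ 0) (A₂∈L a) ∷
    divides (+ 1) (A₃∈L a) ∷ divides (+ 1) (A₄∈L a) ∷ divides (+ 2) (A₅∈L a) ∷ []
    where
    f∈L : ∀ a →
      let g₂ = + 1 + a * (+ 12 + a * (+ 8 + a * + 32))
          g₃ = a * (a * (+ 48 + a * (+ 32 + a * + 128))) - + 1
          g₄ = + 2 + a * (+ 14 + a * (+ 64 + a * (+ 64 + a * + 128)))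
          g₅ = + 2 + a * (+ 30 + a * (+ 120 + a * (+ 128 + a * + 256))) in
      (+ 2 * a + - + 1) * + 1 + ((+ 2 * a + + 1) * g₂ + ((+ 2 * a + + 0) * g₃ + ((+ 2 * a + + 2) * g₄ + ((+ 2 * a + - + 1) * g₅ + + 0))))
        ≡ + 2 * (+ 1 + a * (+ 10 + a * (+ 64 + a * (+ 256 + a * (+ 256 + a * + 512)))))
    f∈L = solve-∀
    A₁∈L : ∀ a →
      let g₂ = + 1 + a * (+ 12 + a * (+ 8 + a * + 32))
          g₃ = a * (a * (+ 48 + a * (+ 32 + a * + 128))) - + 1
          g₄ = + 2 + a * (+ 14 + a * (+ 64 + a * (+ 64 + a * + 128)))
          g₅ = + 2 + a * (+ 30 + a * (+ 120 + a * (+ 128 + a * + 256))) in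
      (+ 4 * a + + 0) * + 1 + (+ 1 * g₂ + (+ 1 * g₃ + (+ 1 * g₄ + ((- + 1) * g₅ + + 0))))
        ≡ + 0 * (+ 1 + a * (+ 10 + a * (+ 64 + a * (+ 256 + a * (+ 256 + a * + 512)))))
    A₁∈L = solve-∀
    A₂∈L : ∀ a →
      let g₂ = + 1 + a * (+ 12 + a * (+ 8 + a * + 32))
          g₃ = a * (a * (+ 48 + a * (+ 32 + a * + 128))) - + 1
          g₄ = + 2 + a * (+ 14 + a * (+ 64 + a * (+ 64 + a * + 128)))
          g₅ = + 2 + a * (+ 30 + a * (+ 120 + a * (+ 128 + a * + 256))) in
      (- + 1) * + 1 + ((+ 4 * a + + 1) * g₂ + (+ 0 * g₃ + (+ 1 * g₄ + ((- + 1) * g₅ + + 0))))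
        ≡ + 0 * (+ 1 + a * (+ 10 + a * (+ 64 + a * (+ 256 + a * (+ 256 + a * + 512)))))
    A₂∈L = solve-∀
    A₃∈L : ∀ a →
      let g₂ = + 1 + a * (+ 12 + a * (+ 8 + a * + 32))
          g₃ = a * (a * (+ 48 + a * (+ 32 + a * + 128))) - + 1
          g₄ = + 2 + a * (+ 14 + a * (+ 64 + a * (+ 64 + a * + 128)))
          g₅ = + 2 + a * (+ 30 + a * (+ 120 + a * (+ 128 + a * + 256))) in
      (- + 1) * + 1 + (+ 0 * g₂ + ((+ 4 * a + + 0) * g₃ + (+ 1 * g₄ + (+ 0 * g₅ + + 0))))
        ≡ + 1 * (+ 1 + a * (+ 10 + a * (+ 64 + a * (+ 256 + a * (+ 256 + a * + 512)))))
    A₃∈L = solve-∀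
    A₄∈L : ∀ a →
      let g₂ = + 1 + a * (+ 12 + a * (+ 8 + a * + 32))
          g₃ = a * (a * (+ 48 + a * (+ 32 + a * + 128))) - + 1
          g₄ = + 2 + a * (+ 14 + a * (+ 64 + a * (+ 64 + a * + 128)))
          g₅ = + 2 + a * (+ 30 + a * (+ 120 + a * (+ 128 + a * + 256))) in
      (- + 1) * + 1 + ((- + 1) * g₂ + ((- + 1) * g₃ + ((+ 4 * a + + 1) * g₄ + (+ 0 * g₅ + + 0))))
        ≡ + 1 * (+ 1 + a * (+ 10 + a * (+ 64 + a * (+ 256 + a * (+ 256 + a * + 512)))))
    A₄∈L = solve-∀
    A₅∈L : ∀ a →
      let g₂ = + 1 + a * (+ 12 + a * (+ 8 + a * + 32))
          g₃ = a * (a * (+ 48 + a * (+ 32 + a * + 128))) - + 1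
          g₄ = + 2 + a * (+ 14 + a * (+ 64 + a * (+ 64 + a * + 128)))
          g₅ = + 2 + a * (+ 30 + a * (+ 120 + a * (+ 128 + a * + 256))) in
      + 1 * + 1 + (+ 1 * g₂ + (+ 0 * g₃ + (+ 0 * g₄ + ((+ 4 * a + + 0) * g₅ + + 0))))
        ≡ + 2 * (+ 1 + a * (+ 10 + a * (+ 64 + a * (+ 256 + a * (+ 256 + a * + 512)))))
    A₅∈L = solve-∀

radius : Affine
radius = (+ 5) a+ 0ℤ

-- The lattice vectors Σ cᵢ Aᵢ and ½ Σ cᵢ Aᵢ (for odd cᵢ).
whole half : (c₁ c₂ c₃ c₄ c₅ : ℤ) → Tree 5 6
whole c₁ c₂ c₃ c₄ c₅ = leaf (0ℤ ∷ c₁ ∷ c₂ ∷ c₃ ∷ c₄ ∷ c₅ ∷ [])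
half  c₁ c₂ c₃ c₄ c₅ = leaf (1ℤ ∷ map (λ c → (c - 1ℤ) /ℕ 2) (c₁ ∷ c₂ ∷ c₃ ∷ c₄ ∷ c₅ ∷ []))

infixr 2 _≼_⇒_⨾_ _≻_⇒_⨾_
-- Guarded notation: the tree after `⇒` handles the points that pass the test, the tree after `⨾`
-- the others. A chain of tests thus reads from top to bottom.
_≼_⇒_⨾_ _≻_⇒_⨾_ : Fin 5 → Affine → Tree 5 6 → Tree 5 6 → Tree 5 6
i ≼ θ ⇒ t ⨾ u = split i θ t u
i ≻ θ ⇒ t ⨾ u = split i θ u t

private
  x₁ x₂ x₃ x₄ x₅ : Fin 5
  x₁ = # 0
  x₂ = # 1
  x₃ = # 2
  x₄ = # 3
  x₅ = # 4
  ⁻ ⁰ ⁺ ³ : ℤ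
  ⁻ = -1ℤ
  ⁰ = 0ℤ
  ⁺ = 1ℤ
  ³ = + 3

pattern S+ = Sign.+
pattern S- = Sign.-

-- One tree for each orthant with x₁ > 0, indexed by the signs of x₂, …, x₅; valid for a ≥ 2.
tree : (p₂ p₃ p₄ p₅ : Sign) → Tree 5 6
tree S+ S+ S+ S+ =
  -- The first tests remove the coordinates well above 2a. If 2a + 2 < x₁ ≤ 4a, for instance,
  -- subtracting A₁ lowers |x₁| by at least 6 and raises the other entries by at most 4 in total; if
  -- x₁ > 4a, the gain is 4a, at least 8. Later tests sharpen the thresholds once more is known
  -- about the other coordinates.
  x₁ ≻ 2a+ (+ 2) ⇒ whole ⁺ ⁰ ⁰ ⁰ ⁰ ⨾
  x₂ ≻ 2a+ (+ 2) ⇒ whole ⁰ ⁺ ⁰ ⁰ ⁰ ⨾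
  x₃ ≻ 2a+ (+ 1) ⇒ whole ⁰ ⁰ ⁺ ⁰ ⁰ ⨾
  x₄ ≻ 2a+ (+ 2) ⇒ whole ⁰ ⁰ ⁰ ⁺ ⁰ ⨾
  x₅ ≻ 2a+ (+ 0) ⇒ whole ⁰ ⁰ ⁰ ⁰ ⁺ ⨾
  x₂ ≻ const (+ 0) ⇒ (
    x₁ ≻ 2a+ (+ 1) ⇒ whole ⁺ ⁰ ⁰ ⁰ ⁰ ⨾
    x₅ ≻ 2a+ (-[1+ 0 ]) ⇒ whole ⁰ ⁰ ⁰ ⁰ ⁺ ⨾
    x₁ ≻ 2a+ (+ 0) ⇒ (
      x₃ ≻ const (+ 0) ⇒ whole ⁺ ⁰ ⁰ ⁰ ⁰ ⨾
      x₄ ≼ const (+ 0) ⇒ half ⁺ ⁺ ⁻ ⁻ ⁺ ⨾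
      whole ⁺ ⁰ ⁰ ⁰ ⁰) ⨾
    x₄ ≼ const (+ 0) ⇒ half ⁺ ⁺ ⁺ ⁻ ⁺ ⨾
    x₂ ≻ 2a+ (+ 1) ⇒ whole ⁰ ⁺ ⁰ ⁰ ⁰ ⨾
    x₃ ≻ 2a+ (+ 0) ⇒ whole ⁰ ⁰ ⁺ ⁰ ⁰ ⨾
    -- The upper bounds collected on this branch are exactly the entries of w = ½ Σ Aᵢ. So x lies
    -- between 0 and w, and ‖x - w‖ = (2k + 1) - (k + 1) = k.
    x₁ ≼ 2a+ (-[1+ 0 ]) ⇒ half ⁺ ⁺ ⁺ ⁺ ⁺ ⨾
    x₃ ≻ const (+ 0) ⇒ whole ⁺ ⁰ ⁰ ⁰ ⁰ ⨾
    x₄ ≼ 2a+ (+ 1) ⇒ half ⁺ ⁺ ⁻ ⁺ ⁺ ⨾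
    whole ⁺ ⁰ ⁰ ⁺ ⁰) ⨾
  x₃ ≼ const (+ 0) ⇒ (
    x₄ ≼ const (+ 1) ⇒ whole ⁺ ⁰ ⁰ ⁰ ⁰ ⨾
    x₁ ≻ 2a+ (+ 1) ⇒ whole ⁺ ⁰ ⁰ ⁰ ⁰ ⨾
    x₄ ≼ 2a+ (+ 0) ⇒ half ⁺ ⁻ ⁻ ⁺ ⁺ ⨾
    x₁ ≻ 2a+ (+ 0) ⇒ whole ⁺ ⁰ ⁰ ⁺ ⁰ ⨾
    x₄ ≼ 2a+ (+ 1) ⇒ half ⁺ ⁻ ⁺ ⁺ ⁺ ⨾
    x₅ ≻ 2a+ (-[1+ 0 ]) ⇒ whole ⁰ ⁰ ⁰ ⁺ ⁺ ⨾
    x₁ ≼ 2a+ (-[1+ 0 ]) ⇒ half ⁺ ⁺ ⁺ ⁺ ⁺ ⨾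
    whole ⁺ ⁰ ⁰ ⁺ ⁰) ⨾
  x₁ ≻ 2a+ (+ 1) ⇒ whole ⁺ ⁰ ⁰ ⁰ ⁰ ⨾
  x₄ ≼ const (+ 0) ⇒ half ⁺ ⁻ ⁺ ⁻ ⁺ ⨾
  x₁ ≻ 2a+ (+ 0) ⇒ whole ⁺ ⁰ ⁰ ⁰ ⁰ ⨾
  x₃ ≻ 2a+ (+ 0) ⇒ whole ⁰ ⁰ ⁺ ⁰ ⁰ ⨾
  x₄ ≼ 2a+ (+ 1) ⇒ half ⁺ ⁻ ⁺ ⁺ ⁺ ⨾
  x₅ ≻ 2a+ (-[1+ 0 ]) ⇒ whole ⁰ ⁰ ⁰ ⁺ ⁺ ⨾
  x₁ ≼ 2a+ (-[1+ 0 ]) ⇒ half ⁺ ⁺ ⁺ ⁺ ⁺ ⨾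
  whole ⁺ ⁰ ⁰ ⁺ ⁰
tree S+ S+ S+ S- =
  x₂ ≻ 2a+ (+ 1) ⇒ whole ⁰ ⁺ ⁰ ⁰ ⁰ ⨾
  x₃ ≻ 2a+ (+ 1) ⇒ whole ⁰ ⁰ ⁺ ⁰ ⁰ ⨾
  x₄ ≻ 2a+ (+ 2) ⇒ whole ⁰ ⁰ ⁰ ⁺ ⁰ ⨾
  x₅ ≼ -2a+ (-[1+ 1 ]) ⇒ whole ⁰ ⁰ ⁰ ⁰ ⁻ ⨾
  x₄ ≼ const (+ 0) ⇒ (
    x₁ ≼ 2a+ (-[1+ 0 ]) ⇒ half ⁺ ⁺ ⁺ ⁻ ⁻ ⨾
    x₁ ≻ 2a+ (+ 0) ⇒ (
      x₂ ≻ const (+ 0) ⇒ whole ⁺ ⁰ ⁰ ⁰ ⁰ ⨾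
      x₃ ≼ const (+ 0) ⇒ whole ⁺ ⁰ ⁰ ⁰ ⁰ ⨾
      whole ⁺ ⁰ ⁰ ⁰ ⁰) ⨾
    x₃ ≼ const (+ 0) ⇒ half ⁺ ⁺ ⁻ ⁻ ⁻ ⨾
    x₅ ≼ -2a+ (-[1+ 0 ]) ⇒ whole ⁺ ⁰ ⁰ ⁰ ⁻ ⨾
    x₂ ≼ const (+ 0) ⇒ half ⁺ ⁻ ⁺ ⁻ ⁻ ⨾
    whole ⁺ ⁰ ⁰ ⁰ ⁰) ⨾
  x₁ ≻ 2a+ (+ 0) ⇒ whole ⁺ ⁰ ⁰ ⁰ ⁰ ⨾
  x₂ ≻ 2a+ (+ 0) ⇒ whole ⁰ ⁺ ⁰ ⁰ ⁰ ⨾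
  x₃ ≻ 2a+ (+ 0) ⇒ whole ⁰ ⁰ ⁺ ⁰ ⁰ ⨾
  x₁ ≼ 2a+ (-[1+ 1 ]) ⇒ half ⁺ ⁺ ⁺ ⁺ ⁻ ⨾
  x₄ ≻ 2a+ (+ 1) ⇒ whole ⁺ ⁰ ⁰ ⁺ ⁰ ⨾
  x₁ ≼ 2a+ (-[1+ 0 ]) ⇒ (
    x₃ ≼ const (+ 0) ⇒ half ⁺ ⁺ ⁻ ⁺ ⁻ ⨾
    x₅ ≼ -2a+ (-[1+ 0 ]) ⇒ whole ⁺ ⁰ ⁰ ⁰ ⁻ ⨾
    x₂ ≼ const (+ 0) ⇒ half ⁺ ⁻ ⁺ ⁺ ⁻ ⨾
    whole ⁺ ⁰ ⁰ ⁰ ⁰) ⨾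
  x₂ ≻ const (+ 0) ⇒ whole ⁺ ⁰ ⁰ ⁰ ⁰ ⨾
  x₃ ≻ const (+ 0) ⇒ whole ⁺ ⁰ ⁰ ⁰ ⁰ ⨾
  x₄ ≻ 2a+ (+ 0) ⇒ whole ⁺ ⁰ ⁰ ⁺ ⁰ ⨾
  x₅ ≼ -2a+ (-[1+ 0 ]) ⇒ whole ⁺ ⁰ ⁰ ⁰ ⁻ ⨾
  half ⁺ ⁻ ⁻ ⁺ ⁻
tree S+ S+ S- S+ =
  x₁ ≻ 2a+ (+ 2) ⇒ whole ⁺ ⁰ ⁰ ⁰ ⁰ or half ³ ⁻ ⁻ ⁻ ⁺ ⨾
  x₂ ≻ 2a+ (+ 2) ⇒ whole ⁰ ⁺ ⁰ ⁰ ⁰ ⨾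
  x₃ ≻ 2a+ (+ 1) ⇒ whole ⁰ ⁰ ⁺ ⁰ ⁰ ⨾
  x₄ ≼ -2a+ (-[1+ 1 ]) ⇒ whole ⁰ ⁰ ⁰ ⁻ ⁰ ⨾
  x₅ ≻ 2a+ (+ 0) ⇒ whole ⁰ ⁰ ⁰ ⁰ ⁺ ⨾
  x₂ ≼ const (+ 0) ⇒ (
    x₃ ≼ const (+ 0) ⇒ half ⁺ ⁻ ⁻ ⁻ ⁺ ⨾
    x₄ ≼ -2a+ (-[1+ 0 ]) ⇒ whole ⁰ ⁰ ⁰ ⁻ ⁰ ⨾
    x₁ ≼ 2a+ (+ 1) ⇒ half ⁺ ⁻ ⁺ ⁻ ⁺ ⨾
    whole ⁺ ⁰ ⁰ ⁰ ⁰) ⨾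
  x₁ ≻ 2a+ (+ 1) ⇒ whole ⁺ ⁰ ⁰ ⁰ ⁰ ⨾
  x₄ ≼ -2a+ (-[1+ 0 ]) ⇒ whole ⁰ ⁰ ⁰ ⁻ ⁰ ⨾
  x₅ ≻ 2a+ (-[1+ 0 ]) ⇒ whole ⁰ ⁰ ⁰ ⁰ ⁺ ⨾
  x₃ ≼ const (+ 0) ⇒ half ⁺ ⁺ ⁻ ⁻ ⁺ ⨾
  x₄ ≼ -2a+ (+ 0) ⇒ whole ⁰ ⁰ ⁰ ⁻ ⁰ ⨾
  x₁ ≼ 2a+ (+ 0) ⇒ half ⁺ ⁺ ⁺ ⁻ ⁺ ⨾
  whole ⁺ ⁰ ⁰ ⁰ ⁰
tree S+ S+ S- S- =
  x₁ ≻ 2a+ (+ 1) ⇒ whole ⁺ ⁰ ⁰ ⁰ ⁰ ⨾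
  x₂ ≻ 2a+ (+ 1) ⇒ whole ⁰ ⁺ ⁰ ⁰ ⁰ ⨾
  x₃ ≻ 2a+ (+ 1) ⇒ whole ⁰ ⁰ ⁺ ⁰ ⁰ ⨾
  x₄ ≼ -2a+ (-[1+ 1 ]) ⇒ whole ⁰ ⁰ ⁰ ⁻ ⁰ ⨾
  x₅ ≼ -2a+ (-[1+ 1 ]) ⇒ whole ⁰ ⁰ ⁰ ⁰ ⁻ ⨾
  x₂ ≻ const (+ 0) ⇒ (
    x₁ ≻ 2a+ (+ 0) ⇒ whole ⁺ ⁰ ⁰ ⁰ ⁰ ⨾
    x₄ ≼ -2a+ (-[1+ 0 ]) ⇒ whole ⁰ ⁰ ⁰ ⁻ ⁰ ⨾
    x₃ ≼ const (+ 0) ⇒ half ⁺ ⁺ ⁻ ⁻ ⁻ ⨾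
    x₄ ≼ -2a+ (+ 0) ⇒ whole ⁰ ⁰ ⁰ ⁻ ⁰ ⨾
    x₁ ≼ 2a+ (-[1+ 0 ]) ⇒ half ⁺ ⁺ ⁺ ⁻ ⁻ ⨾
    whole ⁺ ⁰ ⁰ ⁰ ⁰) ⨾
  x₃ ≼ const (+ 0) ⇒ (
    x₅ ≻ -2a+ (-[1+ 0 ]) ⇒ half ⁺ ⁻ ⁻ ⁻ ⁻ ⨾
    x₁ ≻ 2a+ (+ 0) ⇒ whole ⁺ ⁰ ⁰ ⁰ ⁻ ⨾
    x₄ ≼ -2a+ (-[1+ 0 ]) ⇒ whole ⁰ ⁰ ⁰ ⁻ ⁻ ⨾
    half ⁺ ⁺ ⁻ ⁻ ⁻) ⨾
  x₁ ≻ 2a+ (+ 0) ⇒ whole ⁺ ⁰ ⁰ ⁰ ⁰ ⨾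
  x₄ ≼ -2a+ (-[1+ 0 ]) ⇒ whole ⁰ ⁰ ⁰ ⁻ ⁰ ⨾
  x₅ ≻ -2a+ (-[1+ 0 ]) ⇒ half ⁺ ⁻ ⁺ ⁻ ⁻ ⨾
  x₁ ≻ 2a+ (-[1+ 0 ]) ⇒ whole ⁺ ⁰ ⁰ ⁰ ⁻ ⨾
  x₄ ≼ -2a+ (+ 0) ⇒ whole ⁰ ⁰ ⁰ ⁻ ⁻ ⨾
  half ⁺ ⁺ ⁺ ⁻ ⁻
tree S+ S- S+ S+ =
  x₁ ≻ 2a+ (+ 2) ⇒ whole ⁺ ⁰ ⁰ ⁰ ⁰ or whole ⁺ ⁰ ⁻ ⁰ ⁰ ⨾
  x₂ ≻ 2a+ (+ 2) ⇒ whole ⁰ ⁺ ⁰ ⁰ ⁰ ⨾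
  x₃ ≼ -2a+ (-[1+ 0 ]) ⇒ whole ⁰ ⁰ ⁻ ⁰ ⁰ ⨾
  x₄ ≻ 2a+ (+ 1) ⇒ whole ⁰ ⁰ ⁰ ⁺ ⁰ ⨾
  x₅ ≻ 2a+ (+ 0) ⇒ whole ⁰ ⁰ ⁰ ⁰ ⁺ ⨾
  x₂ ≼ const (+ 0) ⇒ (
    x₁ ≻ 2a+ (+ 1) ⇒ (
      x₃ ≼ -2a+ (+ 0) ⇒ whole ⁺ ⁰ ⁻ ⁰ ⁰ ⨾
      x₄ ≼ const (+ 0) ⇒ half ⁺ ⁻ ⁻ ⁻ ⁺ ⨾
      whole ⁺ ⁰ ⁰ ⁰ ⁰) ⨾
    x₄ ≼ 2a+ (+ 0) ⇒ half ⁺ ⁻ ⁻ ⁺ ⁺ ⨾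
    x₅ ≻ 2a+ (-[1+ 0 ]) ⇒ whole ⁰ ⁰ ⁰ ⁺ ⁺ ⨾
    x₁ ≼ 2a+ (+ 0) ⇒ half ⁺ ⁺ ⁻ ⁺ ⁺ ⨾
    whole ⁺ ⁰ ⁰ ⁺ ⁰) ⨾
  x₁ ≻ 2a+ (+ 1) ⇒ whole ⁺ ⁰ ⁰ ⁰ ⁰ ⨾
  x₅ ≻ 2a+ (-[1+ 0 ]) ⇒ whole ⁰ ⁰ ⁰ ⁰ ⁺ ⨾
  x₁ ≻ 2a+ (+ 0) ⇒ (
    x₃ ≼ -2a+ (+ 0) ⇒ whole ⁺ ⁰ ⁻ ⁰ ⁰ ⨾
    x₄ ≼ const (+ 0) ⇒ half ⁺ ⁺ ⁻ ⁻ ⁺ ⨾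
    whole ⁺ ⁰ ⁰ ⁰ ⁰) ⨾
  x₂ ≼ 2a+ (+ 1) ⇒ half ⁺ ⁺ ⁻ ⁺ ⁺ ⨾
  x₃ ≼ -2a+ (+ 0) ⇒ whole ⁰ ⁺ ⁻ ⁰ ⁰ ⨾
  x₄ ≼ const (+ 0) ⇒ half ⁺ ⁺ ⁻ ⁻ ⁺ ⨾
  whole ⁰ ⁺ ⁰ ⁰ ⁰
tree S+ S- S+ S- =
  x₁ ≻ 2a+ (+ 1) ⇒ whole ⁺ ⁰ ⁰ ⁰ ⁰ ⨾
  x₂ ≻ 2a+ (+ 1) ⇒ whole ⁰ ⁺ ⁰ ⁰ ⁰ ⨾
  x₃ ≼ -2a+ (-[1+ 0 ]) ⇒ whole ⁰ ⁰ ⁻ ⁰ ⁰ ⨾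
  x₄ ≻ 2a+ (+ 1) ⇒ whole ⁰ ⁰ ⁰ ⁺ ⁰ ⨾
  x₅ ≼ -2a+ (-[1+ 1 ]) ⇒ whole ⁰ ⁰ ⁰ ⁰ ⁻ ⨾
  x₁ ≻ 2a+ (+ 0) ⇒ (
    x₂ ≻ const (+ 0) ⇒ whole ⁺ ⁰ ⁰ ⁰ ⁰ ⨾
    x₃ ≼ -2a+ (+ 0) ⇒ whole ⁺ ⁰ ⁻ ⁰ ⁰ ⨾
    x₄ ≻ const (+ 0) ⇒ whole ⁺ ⁰ ⁰ ⁰ ⁰ ⨾
    x₅ ≼ -2a+ (-[1+ 0 ]) ⇒ whole ⁺ ⁰ ⁰ ⁰ ⁻ ⨾
    half ⁺ ⁻ ⁻ ⁻ ⁻) ⨾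
  x₄ ≼ const (+ 0) ⇒ (
    x₃ ≻ -2a+ (+ 0) ⇒ half ⁺ ⁺ ⁻ ⁻ ⁻ ⨾
    x₂ ≻ 2a+ (+ 0) ⇒ whole ⁰ ⁺ ⁻ ⁰ ⁰ ⨾
    x₁ ≼ 2a+ (-[1+ 0 ]) ⇒ half ⁺ ⁺ ⁻ ⁺ ⁻ ⨾
    x₂ ≻ const (+ 0) ⇒ whole ⁺ ⁰ ⁻ ⁰ ⁰ ⨾
    x₅ ≼ -2a+ (+ 0) ⇒ half ⁺ ⁻ ⁻ ⁺ ⁻ ⨾
    half ⁺ ⁻ ⁻ ⁺ ⁻) ⨾
  x₂ ≻ 2a+ (+ 0) ⇒ whole ⁰ ⁺ ⁰ ⁰ ⁰ ⨾
  x₁ ≼ 2a+ (-[1+ 0 ]) ⇒ half ⁺ ⁺ ⁻ ⁺ ⁻ ⨾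
  x₂ ≻ const (+ 0) ⇒ whole ⁺ ⁰ ⁰ ⁰ ⁰ ⨾
  x₄ ≻ 2a+ (+ 0) ⇒ whole ⁺ ⁰ ⁰ ⁺ ⁰ ⨾
  x₅ ≼ -2a+ (-[1+ 0 ]) ⇒ whole ⁺ ⁰ ⁰ ⁰ ⁻ ⨾
  half ⁺ ⁻ ⁻ ⁺ ⁻
tree S+ S- S- S+ =
  x₁ ≻ 2a+ (+ 2) ⇒ whole ⁺ ⁰ ⁰ ⁰ ⁰ or whole ⁺ ⁰ ⁻ ⁰ ⁰ ⨾
  x₂ ≻ 2a+ (+ 2) ⇒ whole ⁰ ⁺ ⁰ ⁰ ⁰ ⨾
  x₃ ≼ -2a+ (+ 0) ⇒ whole ⁰ ⁰ ⁻ ⁰ ⁰ ⨾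
  x₄ ≼ -2a+ (-[1+ 1 ]) ⇒ whole ⁰ ⁰ ⁰ ⁻ ⁰ ⨾
  x₅ ≻ 2a+ (+ 0) ⇒ whole ⁰ ⁰ ⁰ ⁰ ⁺ ⨾
  x₂ ≼ const (+ 0) ⇒ half ⁺ ⁻ ⁻ ⁻ ⁺ ⨾
  x₄ ≼ -2a+ (-[1+ 0 ]) ⇒ whole ⁰ ⁰ ⁰ ⁻ ⁰ ⨾
  x₅ ≻ 2a+ (-[1+ 0 ]) ⇒ whole ⁰ ⁰ ⁰ ⁰ ⁺ ⨾
  x₁ ≼ 2a+ (+ 1) ⇒ half ⁺ ⁺ ⁻ ⁻ ⁺ ⨾
  whole ⁺ ⁰ ⁰ ⁰ ⁰
tree S+ S- S- S- =
  x₁ ≻ 2a+ (+ 1) ⇒ whole ⁺ ⁰ ⁰ ⁰ ⁰ ⨾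
  x₂ ≻ 2a+ (+ 1) ⇒ whole ⁰ ⁺ ⁰ ⁰ ⁰ ⨾
  x₃ ≼ -2a+ (+ 0) ⇒ whole ⁰ ⁰ ⁻ ⁰ ⁰ ⨾
  x₄ ≼ -2a+ (-[1+ 1 ]) ⇒ whole ⁰ ⁰ ⁰ ⁻ ⁰ ⨾
  x₅ ≼ -2a+ (-[1+ 1 ]) ⇒ whole ⁰ ⁰ ⁰ ⁰ ⁻ ⨾
  x₁ ≻ 2a+ (+ 0) ⇒ (
    x₂ ≻ const (+ 0) ⇒ whole ⁺ ⁰ ⁰ ⁰ ⁰ ⨾
    x₅ ≼ -2a+ (-[1+ 0 ]) ⇒ whole ⁺ ⁰ ⁰ ⁰ ⁻ ⨾
    half ⁺ ⁻ ⁻ ⁻ ⁻) ⨾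
  x₄ ≻ -2a+ (-[1+ 0 ]) ⇒ half ⁺ ⁺ ⁻ ⁻ ⁻ ⨾
  x₅ ≼ -2a+ (-[1+ 0 ]) ⇒ whole ⁰ ⁰ ⁰ ⁻ ⁻ ⨾
  x₂ ≼ const (+ 0) ⇒ half ⁺ ⁻ ⁻ ⁻ ⁻ ⨾
  whole ⁰ ⁰ ⁰ ⁻ ⁰
tree S- S+ S+ S+ =
  x₁ ≻ 2a+ (+ 2) ⇒ whole ⁺ ⁰ ⁰ ⁰ ⁰ or whole ⁺ ⁻ ⁰ ⁰ ⁰ ⨾
  x₂ ≼ -2a+ (-[1+ 1 ]) ⇒ whole ⁰ ⁻ ⁰ ⁰ ⁰ ⨾
  x₃ ≻ 2a+ (+ 1) ⇒ whole ⁰ ⁰ ⁺ ⁰ ⁰ ⨾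
  x₄ ≻ 2a+ (+ 1) ⇒ whole ⁰ ⁰ ⁰ ⁺ ⁰ ⨾
  x₅ ≻ 2a+ (+ 0) ⇒ whole ⁰ ⁰ ⁰ ⁰ ⁺ ⨾
  x₁ ≻ 2a+ (+ 0) ⇒ (
    x₂ ≼ -2a+ (-[1+ 0 ]) ⇒ whole ⁺ ⁻ ⁰ ⁰ ⁰ ⨾
    x₄ ≻ 2a+ (+ 0) ⇒ whole ⁺ ⁰ ⁰ ⁺ ⁰ ⨾
    x₁ ≼ 2a+ (+ 1) ⇒ (
      x₃ ≼ const (+ 0) ⇒ half ⁺ ⁻ ⁻ ⁺ ⁺ ⨾
      x₄ ≻ const (+ 0) ⇒ whole ⁺ ⁰ ⁰ ⁰ ⁰ ⨾
      x₂ ≼ -2a+ (+ 0) ⇒ whole ⁺ ⁻ ⁰ ⁰ ⁰ ⨾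
      half ⁺ ⁻ ⁺ ⁻ ⁺) ⨾
    x₂ ≼ -2a+ (+ 0) ⇒ whole ⁺ ⁻ ⁰ ⁰ ⁰ ⨾
    x₃ ≻ const (+ 0) ⇒ whole ⁺ ⁰ ⁰ ⁰ ⁰ ⨾
    x₄ ≼ const (+ 0) ⇒ half ⁺ ⁻ ⁻ ⁻ ⁺ ⨾
    whole ⁺ ⁰ ⁰ ⁰ ⁰) ⨾
  x₂ ≻ -2a+ (-[1+ 0 ]) ⇒ (
    x₃ ≼ 2a+ (+ 0) ⇒ half ⁺ ⁻ ⁺ ⁺ ⁺ ⨾
    x₄ ≻ const (+ 0) ⇒ whole ⁰ ⁰ ⁺ ⁰ ⁰ ⨾
    x₅ ≼ const (+ 0) ⇒ half ⁺ ⁻ ⁺ ⁻ ⁻ ⨾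
    x₂ ≼ -2a+ (+ 0) ⇒ whole ⁰ ⁻ ⁺ ⁰ ⁰ ⨾
    half ⁺ ⁻ ⁺ ⁻ ⁺) ⨾
  x₃ ≻ 2a+ (+ 0) ⇒ whole ⁰ ⁻ ⁺ ⁰ ⁰ ⨾
  x₅ ≻ const (+ 0) ⇒ whole ⁰ ⁻ ⁰ ⁰ ⁰ ⨾
  x₁ ≼ 2a+ (-[1+ 0 ]) ⇒ half ⁺ ⁻ ⁺ ⁺ ⁻ ⨾
  x₃ ≻ const (+ 0) ⇒ whole ⁺ ⁻ ⁰ ⁰ ⁰ ⨾
  x₄ ≼ 2a+ (-[1+ 1 ]) ⇒ half ⁺ ⁻ ⁻ ⁺ ⁻ ⨾
  half ⁺ ⁻ ⁻ ⁺ ⁻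
tree S- S+ S+ S- =
  x₁ ≻ 2a+ (+ 1) ⇒ whole ⁺ ⁰ ⁰ ⁰ ⁰ ⨾
  x₂ ≼ -2a+ (-[1+ 1 ]) ⇒ whole ⁰ ⁻ ⁰ ⁰ ⁰ ⨾
  x₃ ≻ 2a+ (+ 1) ⇒ whole ⁰ ⁰ ⁺ ⁰ ⁰ ⨾
  x₄ ≻ 2a+ (+ 1) ⇒ whole ⁰ ⁰ ⁰ ⁺ ⁰ ⨾
  x₅ ≼ -2a+ (-[1+ 0 ]) ⇒ whole ⁰ ⁰ ⁰ ⁰ ⁻ ⨾
  x₁ ≼ 2a+ (-[1+ 0 ]) ⇒ (
    x₃ ≼ 2a+ (+ 0) ⇒ half ⁺ ⁻ ⁺ ⁺ ⁻ ⨾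
    x₄ ≻ const (+ 0) ⇒ whole ⁰ ⁰ ⁺ ⁰ ⁰ ⨾
    x₂ ≼ -2a+ (-[1+ 0 ]) ⇒ whole ⁰ ⁻ ⁺ ⁰ ⁰ ⨾
    half ⁺ ⁻ ⁺ ⁻ ⁻) ⨾
  x₄ ≻ 2a+ (+ 0) ⇒ whole ⁺ ⁰ ⁰ ⁺ ⁰ ⨾
  x₁ ≼ 2a+ (+ 0) ⇒ (
    x₃ ≼ const (+ 0) ⇒ half ⁺ ⁻ ⁻ ⁺ ⁻ ⨾
    x₄ ≻ const (+ 0) ⇒ whole ⁺ ⁰ ⁰ ⁰ ⁰ ⨾
    x₂ ≼ -2a+ (-[1+ 0 ]) ⇒ whole ⁺ ⁻ ⁰ ⁰ ⁰ ⨾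
    half ⁺ ⁻ ⁺ ⁻ ⁻) ⨾
  x₂ ≼ -2a+ (-[1+ 0 ]) ⇒ whole ⁺ ⁻ ⁰ ⁰ ⁰ ⨾
  x₃ ≻ const (+ 0) ⇒ whole ⁺ ⁰ ⁰ ⁰ ⁰ ⨾
  x₄ ≼ const (+ 0) ⇒ half ⁺ ⁻ ⁻ ⁻ ⁻ ⨾
  whole ⁺ ⁰ ⁰ ⁰ ⁰
tree S- S+ S- S+ =
  x₁ ≻ 2a+ (+ 2) ⇒ whole ⁺ ⁰ ⁰ ⁰ ⁰ or whole ⁺ ⁻ ⁰ ⁰ ⁰ ⨾
  x₂ ≼ -2a+ (-[1+ 0 ]) ⇒ whole ⁰ ⁻ ⁰ ⁰ ⁰ ⨾
  x₃ ≻ 2a+ (+ 1) ⇒ whole ⁰ ⁰ ⁺ ⁰ ⁰ ⨾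
  x₄ ≼ -2a+ (-[1+ 1 ]) ⇒ whole ⁰ ⁰ ⁰ ⁻ ⁰ ⨾
  x₅ ≻ 2a+ (+ 0) ⇒ whole ⁰ ⁰ ⁰ ⁰ ⁺ ⨾
  x₂ ≻ -2a+ (+ 0) ⇒ (
    x₃ ≼ const (+ 0) ⇒ half ⁺ ⁻ ⁻ ⁻ ⁺ ⨾
    x₄ ≼ -2a+ (-[1+ 0 ]) ⇒ whole ⁰ ⁰ ⁰ ⁻ ⁰ ⨾
    x₁ ≼ 2a+ (+ 1) ⇒ half ⁺ ⁻ ⁺ ⁻ ⁺ ⨾
    whole ⁺ ⁰ ⁰ ⁰ ⁰) ⨾
  x₁ ≻ 2a+ (+ 1) ⇒ whole ⁺ ⁻ ⁰ ⁰ ⁰ ⨾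
  x₅ ≻ const (+ 0) ⇒ whole ⁰ ⁻ ⁰ ⁰ ⁰ ⨾
  x₃ ≼ const (+ 0) ⇒ half ⁺ ⁻ ⁻ ⁻ ⁻ ⨾
  x₄ ≼ -2a+ (-[1+ 0 ]) ⇒ whole ⁰ ⁰ ⁰ ⁻ ⁰ ⨾
  x₁ ≼ 2a+ (+ 0) ⇒ half ⁺ ⁻ ⁺ ⁻ ⁻ ⨾
  whole ⁺ ⁻ ⁰ ⁰ ⁰
tree S- S+ S- S- =
  x₁ ≻ 2a+ (+ 1) ⇒ whole ⁺ ⁰ ⁰ ⁰ ⁰ ⨾
  x₂ ≼ -2a+ (-[1+ 0 ]) ⇒ whole ⁰ ⁻ ⁰ ⁰ ⁰ ⨾
  x₃ ≻ 2a+ (+ 1) ⇒ whole ⁰ ⁰ ⁺ ⁰ ⁰ ⨾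
  x₄ ≼ -2a+ (-[1+ 1 ]) ⇒ whole ⁰ ⁰ ⁰ ⁻ ⁰ ⨾
  x₅ ≼ -2a+ (-[1+ 0 ]) ⇒ whole ⁰ ⁰ ⁰ ⁰ ⁻ ⨾
  x₃ ≼ const (+ 0) ⇒ half ⁺ ⁻ ⁻ ⁻ ⁻ ⨾
  x₄ ≼ -2a+ (-[1+ 0 ]) ⇒ whole ⁰ ⁰ ⁰ ⁻ ⁰ ⨾
  x₁ ≼ 2a+ (+ 0) ⇒ half ⁺ ⁻ ⁺ ⁻ ⁻ ⨾
  whole ⁺ ⁰ ⁰ ⁰ ⁰
tree S- S- S+ S+ =
  x₁ ≻ 2a+ (+ 2) ⇒ whole ⁺ ⁰ ⁰ ⁰ ⁰ or whole ⁺ ⁻ ⁰ ⁰ ⁰ ⨾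
  x₂ ≼ -2a+ (-[1+ 1 ]) ⇒ whole ⁰ ⁻ ⁰ ⁰ ⁰ ⨾
  x₃ ≼ -2a+ (-[1+ 0 ]) ⇒ whole ⁰ ⁰ ⁻ ⁰ ⁰ ⨾
  x₄ ≻ 2a+ (+ 0) ⇒ whole ⁰ ⁰ ⁰ ⁺ ⁰ ⨾
  x₅ ≻ 2a+ (+ 0) ⇒ whole ⁰ ⁰ ⁰ ⁰ ⁺ ⨾
  x₁ ≼ 2a+ (+ 1) ⇒ (
    x₂ ≻ -2a+ (-[1+ 0 ]) ⇒ half ⁺ ⁻ ⁻ ⁺ ⁺ ⨾
    x₅ ≻ const (+ 0) ⇒ whole ⁰ ⁻ ⁰ ⁰ ⁰ ⨾
    x₁ ≼ 2a+ (+ 0) ⇒ half ⁺ ⁻ ⁻ ⁺ ⁻ ⨾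
    whole ⁺ ⁻ ⁰ ⁰ ⁰) ⨾
  x₂ ≼ -2a+ (+ 0) ⇒ whole ⁺ ⁻ ⁰ ⁰ ⁰ ⨾
  x₃ ≼ -2a+ (+ 0) ⇒ whole ⁺ ⁰ ⁻ ⁰ ⁰ ⨾
  x₄ ≼ const (+ 0) ⇒ half ⁺ ⁻ ⁻ ⁻ ⁺ ⨾
  whole ⁺ ⁰ ⁰ ⁰ ⁰
tree S- S- S+ S- =
  x₁ ≻ 2a+ (+ 1) ⇒ whole ⁺ ⁰ ⁰ ⁰ ⁰ ⨾
  x₂ ≼ -2a+ (-[1+ 1 ]) ⇒ whole ⁰ ⁻ ⁰ ⁰ ⁰ ⨾
  x₃ ≼ -2a+ (-[1+ 0 ]) ⇒ whole ⁰ ⁰ ⁻ ⁰ ⁰ ⨾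
  x₄ ≻ 2a+ (+ 0) ⇒ whole ⁰ ⁰ ⁰ ⁺ ⁰ ⨾
  x₅ ≼ -2a+ (-[1+ 0 ]) ⇒ whole ⁰ ⁰ ⁰ ⁰ ⁻ ⨾
  x₁ ≼ 2a+ (+ 0) ⇒ half ⁺ ⁻ ⁻ ⁺ ⁻ ⨾
  x₂ ≼ -2a+ (-[1+ 0 ]) ⇒ whole ⁺ ⁻ ⁰ ⁰ ⁰ ⨾
  x₃ ≼ -2a+ (+ 0) ⇒ whole ⁺ ⁰ ⁻ ⁰ ⁰ ⨾
  x₄ ≼ const (+ 0) ⇒ half ⁺ ⁻ ⁻ ⁻ ⁻ ⨾
  whole ⁺ ⁰ ⁰ ⁰ ⁰
tree S- S- S- S+ =
  x₁ ≻ 2a+ (+ 2) ⇒ whole ⁺ ⁰ ⁰ ⁰ ⁰ or whole ⁺ ⁻ ⁰ ⁰ ⁰ ⨾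
  x₂ ≼ -2a+ (-[1+ 0 ]) ⇒ whole ⁰ ⁻ ⁰ ⁰ ⁰ ⨾
  x₃ ≼ -2a+ (+ 0) ⇒ whole ⁰ ⁰ ⁻ ⁰ ⁰ ⨾
  x₄ ≼ -2a+ (-[1+ 1 ]) ⇒ whole ⁰ ⁰ ⁰ ⁻ ⁰ ⨾
  x₅ ≻ 2a+ (+ 0) ⇒ whole ⁰ ⁰ ⁰ ⁰ ⁺ ⨾
  x₂ ≻ -2a+ (+ 0) ⇒ half ⁺ ⁻ ⁻ ⁻ ⁺ ⨾
  x₅ ≻ const (+ 0) ⇒ whole ⁰ ⁻ ⁰ ⁰ ⁰ ⨾
  x₁ ≼ 2a+ (+ 1) ⇒ half ⁺ ⁻ ⁻ ⁻ ⁻ ⨾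
  whole ⁺ ⁻ ⁰ ⁰ ⁰
tree S- S- S- S- =
  x₁ ≻ 2a+ (+ 1) ⇒ whole ⁺ ⁰ ⁰ ⁰ ⁰ ⨾
  x₂ ≼ -2a+ (-[1+ 0 ]) ⇒ whole ⁰ ⁻ ⁰ ⁰ ⁰ ⨾
  x₃ ≼ -2a+ (+ 0) ⇒ whole ⁰ ⁰ ⁻ ⁰ ⁰ ⨾
  x₄ ≼ -2a+ (-[1+ 1 ]) ⇒ whole ⁰ ⁰ ⁰ ⁻ ⁰ ⨾
  x₅ ≼ -2a+ (-[1+ 0 ]) ⇒ whole ⁰ ⁰ ⁰ ⁰ ⁻ ⨾
  half ⁺ ⁻ ⁻ ⁻ ⁻

-- For a = 1 the inequality 2 · 4a > ‖ A₁ ‖ = 4a + 4 fails, and vectors such as (6, 0, 0, 0, 0) are not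
-- reduced by A₁.
tree₁ : (p₂ p₃ p₄ p₅ : Sign) → Tree 5 6
tree₁ S+ S+ S+ S+ =
  x₁ ≻ const (+ 5) ⇒ half ³ ⁻ ⁻ ⁻ ⁺ ⨾
  x₂ ≻ const (+ 4) ⇒ whole ⁰ ⁺ ⁰ ⁰ ⁰ ⨾
  x₃ ≻ const (+ 3) ⇒ whole ⁰ ⁰ ⁺ ⁰ ⁰ ⨾
  x₄ ≻ const (+ 4) ⇒ whole ⁰ ⁰ ⁰ ⁺ ⁰ ⨾
  x₅ ≻ const (+ 2) ⇒ whole ⁰ ⁰ ⁰ ⁰ ⁺ ⨾
  x₅ ≻ const (+ 1) ⇒ (
    x₁ ≻ const (+ 3) ⇒ half ⁺ ⁻ ⁻ ⁻ ⁺ ⨾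
    x₂ ≻ const (+ 0) ⇒ whole ⁰ ⁰ ⁰ ⁰ ⁺ ⨾
    x₃ ≻ const (+ 2) ⇒ half ⁺ ⁻ ⁺ ⁻ ⁺ ⨾
    x₄ ≻ const (+ 2) ⇒ half ⁺ ⁻ ⁺ ⁺ ⁺ ⨾
    x₄ ≼ const (+ 0) ⇒ half ⁺ ⁻ ⁺ ⁻ ⁺ ⨾
    x₁ ≼ const (+ 2) ⇒ half ⁺ ⁻ ⁺ ⁺ ⁺ ⨾
    half ⁺ ⁻ ⁻ ⁺ ⁺) ⨾
  x₁ ≼ const (+ 2) ⇒ (
    x₄ ≼ const (+ 0) ⇒ half ⁺ ⁺ ⁺ ⁻ ⁺ ⨾
    x₂ ≻ const (+ 3) ⇒ whole ⁰ ⁺ ⁰ ⁰ ⁰ ⨾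
    x₃ ≻ const (+ 2) ⇒ whole ⁰ ⁰ ⁺ ⁰ ⁰ ⨾
    x₁ ≼ const (+ 1) ⇒ half ⁺ ⁺ ⁺ ⁺ ⁺ ⨾
    x₄ ≻ const (+ 3) ⇒ whole ⁺ ⁰ ⁰ ⁺ ⁰ ⨾
    x₂ ≼ const (+ 0) ⇒ half ⁺ ⁻ ⁺ ⁺ ⁺ ⨾
    x₃ ≼ const (+ 0) ⇒ half ⁺ ⁺ ⁻ ⁺ ⁺ ⨾
    whole ⁺ ⁰ ⁰ ⁰ ⁰) ⨾
  x₂ ≻ const (+ 2) ⇒ half ⁺ ⁺ ⁻ ⁻ ⁺ ⨾
  x₃ ≻ const (+ 2) ⇒ half ⁺ ⁻ ⁺ ⁻ ⁺ ⨾
  x₄ ≻ const (+ 2) ⇒ whole ⁺ ⁰ ⁰ ⁺ ⁰ ⨾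
  x₅ ≼ const (+ 0) ⇒ whole ⁺ ⁰ ⁰ ⁰ ⁰ ⨾
  x₁ ≻ const (+ 4) ⇒ half ³ ⁻ ⁻ ⁻ ⁺ ⨾
  x₂ ≻ const (+ 1) ⇒ half ⁺ ⁺ ⁻ ⁻ ⁺ ⨾
  x₃ ≻ const (+ 1) ⇒ half ⁺ ⁻ ⁺ ⁻ ⁺ ⨾
  x₄ ≼ const (+ 1) ⇒ whole ⁺ ⁰ ⁰ ⁰ ⁰ ⨾
  half ⁺ ⁻ ⁻ ⁺ ⁺
tree₁ S+ S+ S+ S- =
  x₁ ≻ const (+ 3) ⇒ whole ⁺ ⁰ ⁰ ⁰ ⁰ ⨾
  x₂ ≻ const (+ 3) ⇒ whole ⁰ ⁺ ⁰ ⁰ ⁰ ⨾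
  x₃ ≻ const (+ 3) ⇒ whole ⁰ ⁰ ⁺ ⁰ ⁰ ⨾
  x₄ ≻ const (+ 3) ⇒ whole ⁺ ⁰ ⁰ ⁺ ⁰ ⨾
  x₅ ≼ const (-[1+ 3 ]) ⇒ whole ⁰ ⁰ ⁰ ⁰ ⁻ ⨾
  x₁ ≼ const (+ 1) ⇒ (
    x₄ ≼ const (+ 0) ⇒ half ⁺ ⁺ ⁺ ⁻ ⁻ ⨾
    x₂ ≻ const (+ 2) ⇒ whole ⁰ ⁺ ⁰ ⁰ ⁰ ⨾
    x₃ ≻ const (+ 2) ⇒ whole ⁰ ⁰ ⁺ ⁰ ⁰ ⨾
    x₃ ≼ const (+ 0) ⇒ half ⁺ ⁺ ⁻ ⁺ ⁻ ⨾
    x₅ ≼ const (-[1+ 2 ]) ⇒ whole ⁺ ⁰ ⁰ ⁰ ⁻ ⨾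
    x₂ ≼ const (+ 0) ⇒ half ⁺ ⁻ ⁺ ⁺ ⁻ ⨾
    whole ⁺ ⁰ ⁰ ⁰ ⁰) ⨾
  x₂ ≻ const (+ 2) ⇒ half ⁺ ⁺ ⁻ ⁻ ⁻ ⨾
  x₃ ≻ const (+ 2) ⇒ half ⁺ ⁻ ⁺ ⁻ ⁻ ⨾
  x₄ ≻ const (+ 2) ⇒ whole ⁺ ⁰ ⁰ ⁺ ⁰ ⨾
  x₅ ≻ const (-[1+ 1 ]) ⇒ whole ⁺ ⁰ ⁰ ⁰ ⁰ ⨾
  x₂ ≻ const (+ 1) ⇒ half ⁺ ⁺ ⁻ ⁻ ⁻ ⨾
  x₃ ≻ const (+ 1) ⇒ half ⁺ ⁻ ⁺ ⁻ ⁻ ⨾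
  x₄ ≻ const (+ 1) ⇒ half ⁺ ⁻ ⁻ ⁺ ⁻ ⨾
  x₅ ≻ const (-[1+ 2 ]) ⇒ whole ⁺ ⁰ ⁰ ⁰ ⁰ ⨾
  x₂ ≼ const (+ 0) ⇒ whole ⁺ ⁰ ⁰ ⁰ ⁻ ⨾
  half ⁺ ⁺ ⁻ ⁻ ⁻
tree₁ p₂ p₃ p₄ p₅ = tree p₂ p₃ p₄ p₅

-- Orthants and the validity of the trees

unit : Sign → ℤ
unit S+ = 1ℤ
unit S- = -1ℤ

-- Zero belongs to the positive side, in accordance with `sign`. The outer bound is ‖x‖ = k + 1 = 5a
-- + 1.
side : Sign → Affine × Affine
side S+ = const 0ℤ , (+ 5) a+ 1ℤ
side S- = (- + 5) a+ -1ℤ , const -1ℤ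

orthant : Vec Sign 4 → Box 5
orthant ps = (const 1ℤ , (+ 5) a+ 1ℤ) ∷ map side ps

-- Here a = b + 2. Once the signs are fixed, `check` is a closed Boolean and evaluates to `true`.
tree-valid : ∀ p₂ p₃ p₄ p₅ → let ps = p₂ ∷ p₃ ∷ p₄ ∷ p₅ ∷ [] in
  T (check 1ℤ (+ 2) basis radius (1ℤ ∷ map unit ps) (orthant ps) (tree p₂ p₃ p₄ p₅))
tree-valid S+ S+ S+ S+ = tt
tree-valid S+ S+ S+ S- = tt
tree-valid S+ S+ S- S+ = tt
tree-valid S+ S+ S- S- = tt
tree-valid S+ S- S+ S+ = tt
tree-valid S+ S- S+ S- = tt
tree-valid S+ S- S- S+ = tt
tree-valid S+ S- S- S- = tt
tree-valid S- S+ S+ S+ = tt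
tree-valid S- S+ S+ S- = tt
tree-valid S- S+ S- S+ = tt
tree-valid S- S+ S- S- = tt
tree-valid S- S- S+ S+ = tt
tree-valid S- S- S+ S- = tt
tree-valid S- S- S- S+ = tt
tree-valid S- S- S- S- = tt

-- The progression 0 · b + 1 is constant, so `rebase` turns every bound into its numerical value at
-- a = 1.
tree₁-valid : ∀ p₂ p₃ p₄ p₅ → let ps = p₂ ∷ p₃ ∷ p₄ ∷ p₅ ∷ [] in
  T (check 0ℤ 1ℤ basis radius (1ℤ ∷ map unit ps) (orthant ps) (tree₁ p₂ p₃ p₄ p₅))
tree₁-valid S+ S+ S+ S+ = tt
tree₁-valid S+ S+ S+ S- = tt
tree₁-valid S+ S+ S- S+ = tt
tree₁-valid S+ S+ S- S- = tt
tree₁-valid S+ S- S+ S+ = tt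
tree₁-valid S+ S- S+ S- = tt
tree₁-valid S+ S- S- S+ = tt
tree₁-valid S+ S- S- S- = tt
tree₁-valid S- S+ S+ S+ = tt
tree₁-valid S- S+ S+ S- = tt
tree₁-valid S- S+ S- S+ = tt
tree₁-valid S- S+ S- S- = tt
tree₁-valid S- S- S+ S+ = tt
tree₁-valid S- S- S+ S- = tt
tree₁-valid S- S- S- S+ = tt
tree₁-valid S- S- S- S- = tt

unit-sign : ∀ x → unit (sign x) * x ≡ + ∣ x ∣
unit-sign (+ x)    = *-identityˡ (+ x)
unit-sign -[1+ x ] = -1*i≡-i -[1+ x ]

units-· : ∀ {r} (xs : Vec ℤ r) → map unit (map sign xs) · xs ≡ + ‖ xs ‖
units-· []       = refl
units-· (x ∷ xs) = cong₂ _+_ (unit-sign x) (units-· xs)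

∈-side : ∀ {a} x → + ∣ x ∣ ≤ + 5 * a + 1ℤ →
  ⟦ proj₁ (side (sign x)) ⟧ a ≤ x × x ≤ ⟦ proj₂ (side (sign x)) ⟧ a
∈-side     (+ x)    le = +≤+ ℕ.z≤n , le
∈-side {a} -[1+ x ] le =
  subst (_≤ -[1+ x ]) (lemma a) (neg-mono-≤ le) , -≤- ℕ.z≤n
  where
  lemma : ∀ a → - (+ 5 * a + + 1) ≡ (- + 5) * a + (- + 1)
  lemma = solve-∀

∈-sides : ∀ {r a} (xs : Vec ℤ r) → + ‖ xs ‖ ≤ + 5 * a + 1ℤ → xs ∈ map side (map sign xs) at a
∈-sides     []       le = tt
∈-sides {a = a} (x ∷ xs) le =
  ∈-side {a} x (≤-trans (+≤+ (ℕ.m≤m+n ∣ x ∣ ‖ xs ‖)) le) ,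
  ∈-sides {a = a} xs (≤-trans (+≤+ (ℕ.m≤n+m ‖ xs ‖ ∣ x ∣)) le)

certified-reduction : ∀ α β (tree : (p₂ p₃ p₄ p₅ : Sign) → Tree 5 6) →
  (∀ p₂ p₃ p₄ p₅ → let ps = p₂ ∷ p₃ ∷ p₄ ∷ p₅ ∷ [] in
    T (check α β basis radius (1ℤ ∷ map unit ps) (orthant ps) (tree p₂ p₃ p₄ p₅))) →
  ∀ b {a} → α * + b + β ≡ a → ∀ x₁ xs → + ‖ + suc x₁ ∷ xs ‖ ≡ + 5 * a + 1ℤ →
  ∃ λ cs → + ‖ (+ suc x₁ ∷ xs) ⊟ ⟦ combine cs basis ⟧ᵛ a ‖ ≤ ⟦ radius ⟧ a
certified-reduction α β tree valid b refl x₁ xs@(x₂ ∷ x₃ ∷ x₄ ∷ x₅ ∷ []) ‖x‖≡ =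
  check-sound α β basis radius b (1ℤ ∷ map unit (map sign xs)) x
    (trans (cong₂ _+_ (*-identityˡ (+ suc x₁)) (units-· xs))
           (trans ‖x‖≡ (cong (_+ 1ℤ) (sym (+-identityʳ (+ 5 * a))))))
    (orthant (map sign xs)) (tree (sign x₂) (sign x₃) (sign x₄) (sign x₅))
    (valid (sign x₂) (sign x₃) (sign x₄) (sign x₅))
    ((+≤+ (ℕ.s≤s ℕ.z≤n) , ≤-trans (+≤+ (ℕ.m≤m+n (suc x₁) ‖ xs ‖)) (≤-reflexive ‖x‖≡)) ,
     ∈-sides {a = a} xs (≤-trans (+≤+ (ℕ.m≤n+m ‖ xs ‖ (suc x₁))) (≤-reflexive ‖x‖≡)))
  where
  a = α * + b + β
  x = + suc x₁ ∷ xs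

reduction : ∀ b x₁ xs → ‖ + suc x₁ ∷ xs ‖ ≡ suc (suc b ℕ.* 5) →
  ∃ λ cs → ‖ (+ suc x₁ ∷ xs) ⊟ ⟦ combine cs basis ⟧ᵛ (+ suc b) ‖ ℕ.≤ suc b ℕ.* 5
reduction b x₁ xs ‖x‖≡ =
  let cs , le = go b (trans (cong +_ ‖x‖≡) 5a+1) in
  cs , drop‿+≤+ (≤-trans le (≤-reflexive (trans (+-identityʳ _) (sym 5a))))
  where
  5a : + (suc b ℕ.* 5) ≡ + 5 * + suc b
  5a = trans (pos-* (suc b) 5) (*-comm (+ suc b) (+ 5))
  5a+1 : + suc (suc b ℕ.* 5) ≡ + 5 * + suc b + 1ℤ
  5a+1 = trans (+-comm 1ℤ (+ (suc b ℕ.* 5))) (cong (_+ 1ℤ) 5a)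
  go : ∀ b → + ‖ + suc x₁ ∷ xs ‖ ≡ + 5 * + suc b + 1ℤ →
    ∃ λ cs → + ‖ (+ suc x₁ ∷ xs) ⊟ ⟦ combine cs basis ⟧ᵛ (+ suc b) ‖ ≤ ⟦ radius ⟧ (+ suc b)
  go zero    = certified-reduction 0ℤ 1ℤ tree₁ tree₁-valid 0 refl x₁ xs
  go (suc b) = certified-reduction 1ℤ (+ 2) tree tree-valid b
    (trans (cong (_+ + 2) (*-identityˡ (+ b))) (+-comm (+ b) (+ 2))) x₁ xs

-- The upper bound on the diameter

module UpperBound (b n : ℕ) (hs : Vec ℤ 4)
  (basis∈L : All (λ v → + n ∣ ⟦ v ⟧ᵛ (+ suc b) · (1ℤ ∷ hs)) basis) where

  private
    gs : Vec ℤ 5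
    gs = 1ℤ ∷ hs

  Covered : ℤ → Set
  Covered v = ∃ λ x → ‖ x ‖ ℕ.≤ suc b ℕ.* 5 × + n ∣ v - x · gs

  covered-0 : Covered 0ℤ
  covered-0 = replicate 5 0ℤ , ℕ.z≤n , divides 0ℤ (cong (_-_ 0ℤ) (·-zeroˡ gs))

  shift : ∀ v x₁ p → v - (x₁ * 1ℤ + p) ≡ (1ℤ + v) - ((1ℤ + x₁) * 1ℤ + p)
  shift = solve-∀

  -- Adding the generator 1 raises the first entry by one. Either the norm stays within k, or it
  -- becomes exactly k + 1 with a positive first entry, and `reduction` finds a lattice vector that
  -- brings it back.
  covered-suc : ∀ v → Covered v → Covered (1ℤ + v)
  covered-suc v (x₁ ∷ xs , ‖x‖≤ , v≡x) with ‖ 1ℤ + x₁ ∷ xs ‖ ℕ.≤? suc b ℕ.* 5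
  ... | yes ‖x′‖≤ = 1ℤ + x₁ ∷ xs , ‖x′‖≤ , subst (+ n ∣_) (shift v x₁ (xs · hs)) v≡x
  -- A negative first entry moves towards 0, so the norm drops and cannot leave the ball.
  covered-suc v (-[1+ zero ] ∷ xs , ‖x‖≤ , v≡x) | no ≰ = contradiction (ℕ.≤-trans (ℕ.n≤1+n _) ‖x‖≤) ≰
  covered-suc v (-[1+ suc m ] ∷ xs , ‖x‖≤ , v≡x) | no ≰ = contradiction (ℕ.≤-trans (ℕ.n≤1+n _) ‖x‖≤) ≰
  covered-suc v (+ m ∷ xs , ‖x‖≤ , v≡x) | no ≰
    -- The old norm is at most k and the new one is not, which forces the new norm to be k + 1.
    with cs , ‖x-w‖≤ ← reduction b m xs (ℕ.≤-antisym (ℕ.s≤s ‖x‖≤) (ℕ.≰⇒> ≰)) =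
    x ⊟ w , ‖x-w‖≤ ,
    subst (+ n ∣_) (trans (lemma (1ℤ + v) (x · gs) (w · gs)) (cong (_-_ (1ℤ + v)) (sym (⊟-· x w gs))))
      (∣m∣n⇒∣m+n (subst (+ n ∣_) (shift v (+ m) (xs · hs)) v≡x)
                 (combine-∣ (+ n) (+ suc b) gs cs basis basis∈L))
    where
    x = + suc m ∷ xs
    w = ⟦ combine cs basis ⟧ᵛ (+ suc b)
    lemma : ∀ v x w → (v - x) + w ≡ v - (x - w)
    lemma = solve-∀

  covered-ℕ : ∀ m → Covered (+ m)
  covered-ℕ zero    = covered-0
  covered-ℕ (suc m) = covered-suc (+ m) (covered-ℕ m)

  covered : .{{_ : ℕ.NonZero n}} → ∀ v → Covered v
  covered v with x , ‖x‖≤ , d ← covered-ℕ (v %ℕ n) =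
    x , ‖x‖≤ , subst (+ n ∣_) (trans (lemma (+ (v %ℕ n)) (v /ℕ n * + n) (x · gs))
      (cong (_- x · gs) (sym (a≡a%ℕn+[a/ℕn]*n v n)))) (∣m∣n⇒∣m+n d (divides (v /ℕ n) refl))
    where
    lemma : ∀ r q x → (r - x) + q ≡ (r + q) - x
    lemma = solve-∀

  dist≤ : ∀ i j → DistLe n gs i j (suc b ℕ.* 5)
  dist≤ i j with x , ‖x‖≤ , d ← covered {{Fin.nonZeroIndex i}} (+ toℕ j - + toℕ i) =
    ‖ x ‖ , ‖x‖≤ , vector⇒walk n gs x i j d

-- Closed forms for k = 5a

orderℕ : ℕ → ℕ
orderℕ a = 1 ℕ.+ a ℕ.* (10 ℕ.+ a ℕ.* (64 ℕ.+ a ℕ.* (256 ℕ.+ a ℕ.* (256 ℕ.+ a ℕ.* 512))))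

-- One step of Horner's scheme carried from ℕ to ℤ; nesting it follows the shape of the polynomials.
pos-horner : ∀ c a {m M} → + m ≡ M → + (c ℕ.+ a ℕ.* m) ≡ + c + + a * M
pos-horner c a {m} refl = cong (_+_ (+ c)) (pos-* a m)

opaque
  unfolding order otherGenerators

  +orderℕ : ∀ a → + orderℕ a ≡ order (+ a)
  +orderℕ a = pos-horner 1 a (pos-horner 10 a (pos-horner 64 a (pos-horner 256 a (pos-horner 256 a refl))))

-- The numerators are homogeneous in k and 5; the identities below have a variable c in place of 5,
-- which keeps their coefficients small.

L-CC-5a : ∀ a → L-CC (a ℕ.* 5) ≡ orderℕ a
L-CC-5a a = trans (cong (ℕ._/ 3125) (numerator a 5)) (ℕ.m*n/n≡m (orderℕ a) 3125)
  where
  -- At c = 5 the coefficients become those of `L-CC`, and the products ending in 1 are the unfolded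
  -- powers of k.
  numerator : ∀ a c → let k = a ℕ.* c in
    512 ℕ.* (k ℕ.* (k ℕ.* (k ℕ.* (k ℕ.* (k ℕ.* 1)))))
      ℕ.+ 256 ℕ.* c ℕ.* (k ℕ.* (k ℕ.* (k ℕ.* (k ℕ.* 1))))
      ℕ.+ 256 ℕ.* (c ℕ.* c) ℕ.* (k ℕ.* (k ℕ.* (k ℕ.* 1)))
      ℕ.+ 64 ℕ.* (c ℕ.* (c ℕ.* c)) ℕ.* (k ℕ.* (k ℕ.* 1))
      ℕ.+ 10 ℕ.* (c ℕ.* (c ℕ.* (c ℕ.* c))) ℕ.* k
      ℕ.+ c ℕ.* (c ℕ.* (c ℕ.* (c ℕ.* c)))
    ≡ (1 ℕ.+ a ℕ.* (10 ℕ.+ a ℕ.* (64 ℕ.+ a ℕ.* (256 ℕ.+ a ℕ.* (256 ℕ.+ a ℕ.* 512)))))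
      ℕ.* (c ℕ.* (c ℕ.* (c ℕ.* (c ℕ.* c))))
  numerator = ℕ.solve-∀

opaque
  unfolding order otherGenerators

  gens-5a : ∀ a .{{_ : ℕ.NonZero a}} → gens (a ℕ.* 5) ≡ generators (+ a)
  gens-5a a = cong (1ℤ ∷_)
    (cong₂ _∷_ (exact 125 (1 ℕ.+ a ℕ.* (12 ℕ.+ a ℕ.* (8 ℕ.+ a ℕ.* 32)))
      (numerator₂ a 5) (pos-horner 1 a (pos-horner 12 a (pos-horner 8 a refl))))
    (cong₂ _∷_ (trans (cong (λ m → (+ m - + 625) /ℕ 625) (numerator₃ a 5)) (trans (drop (a ℕ.* (a ℕ.* y)))
      (cong (_- 1ℤ) (trans (pos-* a (a ℕ.* y)) (cong (+ a *_) (trans (pos-* a y)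
        (cong (+ a *_) (pos-horner 48 a (pos-horner 32 a refl)))))))))
    (cong₂ _∷_ (exact 625 (2 ℕ.+ a ℕ.* (14 ℕ.+ a ℕ.* (64 ℕ.+ a ℕ.* (64 ℕ.+ a ℕ.* 128))))
      (numerator₄ a 5) (pos-horner 2 a (pos-horner 14 a (pos-horner 64 a (pos-horner 64 a refl)))))
    (cong (_∷ []) (exact 625 (2 ℕ.+ a ℕ.* (30 ℕ.+ a ℕ.* (120 ℕ.+ a ℕ.* (128 ℕ.+ a ℕ.* 256))))
      (numerator₅ a 5) (pos-horner 2 a (pos-horner 30 a (pos-horner 120 a (pos-horner 128 a refl)))))))))
    where
    exact : ∀ d .{{_ : ℕ.NonZero d}} {m} q {Q} → m ≡ q ℕ.* d → + q ≡ Q → + (m ℕ./ d) ≡ Q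
    exact d q refl refl = cong +_ (ℕ.m*n/n≡m q d)

    numerator₂ : ∀ a c → let k = a ℕ.* c in
      32 ℕ.* (k ℕ.* (k ℕ.* (k ℕ.* 1))) ℕ.+ 8 ℕ.* c ℕ.* (k ℕ.* (k ℕ.* 1))
        ℕ.+ 12 ℕ.* (c ℕ.* c) ℕ.* k ℕ.+ c ℕ.* (c ℕ.* c)
      ≡ (1 ℕ.+ a ℕ.* (12 ℕ.+ a ℕ.* (8 ℕ.+ a ℕ.* 32))) ℕ.* (c ℕ.* (c ℕ.* c))
    numerator₂ = ℕ.solve-∀
    numerator₃ : ∀ a c → let k = a ℕ.* c in
      128 ℕ.* (k ℕ.* (k ℕ.* (k ℕ.* (k ℕ.* 1)))) ℕ.+ 32 ℕ.* c ℕ.* (k ℕ.* (k ℕ.* (k ℕ.* 1)))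
        ℕ.+ 48 ℕ.* (c ℕ.* c) ℕ.* (k ℕ.* (k ℕ.* 1))
      ≡ a ℕ.* (a ℕ.* (48 ℕ.+ a ℕ.* (32 ℕ.+ a ℕ.* 128))) ℕ.* (c ℕ.* (c ℕ.* (c ℕ.* c)))
    numerator₃ = ℕ.solve-∀
    numerator₄ : ∀ a c → let k = a ℕ.* c in
      128 ℕ.* (k ℕ.* (k ℕ.* (k ℕ.* (k ℕ.* 1)))) ℕ.+ 64 ℕ.* c ℕ.* (k ℕ.* (k ℕ.* (k ℕ.* 1)))
        ℕ.+ 64 ℕ.* (c ℕ.* c) ℕ.* (k ℕ.* (k ℕ.* 1)) ℕ.+ 14 ℕ.* (c ℕ.* (c ℕ.* c)) ℕ.* k
        ℕ.+ 2 ℕ.* (c ℕ.* (c ℕ.* (c ℕ.* c)))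
      ≡ (2 ℕ.+ a ℕ.* (14 ℕ.+ a ℕ.* (64 ℕ.+ a ℕ.* (64 ℕ.+ a ℕ.* 128)))) ℕ.* (c ℕ.* (c ℕ.* (c ℕ.* c)))
    numerator₄ = ℕ.solve-∀
    numerator₅ : ∀ a c → let k = a ℕ.* c in
      256 ℕ.* (k ℕ.* (k ℕ.* (k ℕ.* (k ℕ.* 1)))) ℕ.+ 128 ℕ.* c ℕ.* (k ℕ.* (k ℕ.* (k ℕ.* 1)))
        ℕ.+ 120 ℕ.* (c ℕ.* c) ℕ.* (k ℕ.* (k ℕ.* 1)) ℕ.+ 30 ℕ.* (c ℕ.* (c ℕ.* c)) ℕ.* k
        ℕ.+ 2 ℕ.* (c ℕ.* (c ℕ.* (c ℕ.* c)))
      ≡ (2 ℕ.+ a ℕ.* (30 ℕ.+ a ℕ.* (120 ℕ.+ a ℕ.* (128 ℕ.+ a ℕ.* 256)))) ℕ.* (c ℕ.* (c ℕ.* (c ℕ.* c)))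
    numerator₅ = ℕ.solve-∀

    -- For the third generator, whose numerator 625 y - 625 is formed in ℤ. Since y is a successor,
    -- the difference is a natural multiple of 625, and `_/ℕ_` computes as division in ℕ.
    drop : ∀ y .{{_ : ℕ.NonZero y}} → (+ (y ℕ.* 625) - + 625) /ℕ 625 ≡ + y - 1ℤ
    drop (suc y) = trans (cong (_/ℕ 625) (lemma (+ 625) (+ (y ℕ.* 625)))) (cong +_ (ℕ.m*n/n≡m y 625))
      where
      lemma : ∀ d m → (d + m) - d ≡ m
      lemma = solve-∀
    y : ℕ
    y = 48 ℕ.+ a ℕ.* (32 ℕ.+ a ℕ.* 128)
    instance
      a*y≢0 : ℕ.NonZero (a ℕ.* y)
      a*y≢0 = ℕ.m*n≢0 a y
      a*[a*y]≢0 : ℕ.NonZero (a ℕ.* (a ℕ.* y))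
      a*[a*y]≢0 = ℕ.m*n≢0 a (a ℕ.* y)

-- The diameter of the graph

has-diameter : ∀ b n → Fin n → + n ≡ order (+ suc b) →
  HasDiameter n (generators (+ suc b)) (suc b ℕ.* 5)
has-diameter b n i n≡ =
  UpperBound.dist≤ b n (otherGenerators (+ suc b))
    (subst (λ N → All (λ v → N ∣ ⟦ v ⟧ᵛ (+ suc b) · gs) basis) (sym n≡) (basis∈L (+ suc b))) ,
  -- The distant pair consists of any vertex and its translate by `near`, a vector of norm k that
  -- lies half way along the odd lattice vector ½ Σ Aᵢ.
  i , j , λ ℓ w → LowerBound.far-walk b n gs
    (trans (near+far∈L (+ b)) (cong (+ 2 *_) (sym n≡)))
    (λ q w₁ w₂ w₃ w₄ w₅ w∈L → odd-norm-ℕ b q w₁ w₂ w₃ w₄ w₅ (trans w∈L (cong (q *_) n≡)))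
    i j i⟶j w
  where
  gs = generators (+ suc b)
  j = proj₁ (translate n gs i (near (+ b) · gs))
  i⟶j = proj₂ (translate n gs i (near (+ b) · gs))

theorem3 : (k : ℕ) → 0 < k → k % 5 ≡ 0 →
    HasDiameter (L-CC k) (gens k) k
theorem3 k 0<k k%5≡0 = subst (λ k → HasDiameter (L-CC k) (gens k) k) (sym k≡) (multiple (k ℕ./ 5) k≡)
  where
  k≡ : k ≡ k ℕ./ 5 ℕ.* 5
  k≡ = trans (ℕ.m≡m%n+[m/n]*n k 5) (cong (ℕ._+ k ℕ./ 5 ℕ.* 5) k%5≡0)
  multiple : ∀ a → k ≡ a ℕ.* 5 → HasDiameter (L-CC (a ℕ.* 5)) (gens (a ℕ.* 5)) (a ℕ.* 5)
  multiple zero    refl = contradiction 0<k λ ()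
  multiple (suc b) _    = subst₂ (λ n gs → HasDiameter n gs (suc b ℕ.* 5))
    (sym (L-CC-5a (suc b))) (sym (gens-5a (suc b)))
    -- `orderℕ` is a successor by definition, so `Fin.zero` is a vertex.
    (has-diameter b (orderℕ (suc b)) Fin.zero (+orderℕ (suc b)))
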